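{- There are infinite families $\mathcal F$ of unsatisfiable cnf-xor formulas such that (i) for some polynomial $p$, every $\phi\in\mathcal F$ has a DPLL(XOR) proof of unsatisfiability of size at most $p(|\phi|)$, using the UP-module as the xor-reasoning module, if parity explanations are allowed; but (ii) for no polynomial $p$ does every $\phi\in\mathcal F$ have a DPLL(XOR) proof of unsatisfiability of size at most $p(|\phi|)$, using the UP-module as the xor-reasoning module, if only implicative explanations are used. Here $|\phi|$ denotes the length of $\phi$.
   Context: **Formulas.** An atom is a propositional variable or the constant $\top$; a literal is an atom or its negation; $\bot=\neg\top$, and $\neg\neg A$ is $A$. An or-clause is a disjunction of literals. An xor-clause is $l_1\oplus\dots\oplus l_n$, always taken in normal form (each atom occurs at most once, all literals positive; obtained by $\neg A\oplus C\leadsto A\oplus\top\oplus C$ and $A\oplus A\oplus C\leadsto C$); it is satisfied iff an odd number of its literals are true; the empty clause is $\bot$. Unary xor-clauses are $x$ and $x\oplus\top$, the latter identified with the literal $\neg x$. $C[A/D]$ is the normal form of $C$ with the atom $A$ replaced by $D$. A cnf-xor formula is $\phi=\phi_{\mathrm{or}}\wedge\phi_{\mathrm{xor}}$, a conjunction of or-clauses and a conjunction of xor-clauses. **UP-derivations.** Let $\psi=\phi_{\mathrm{xor}}\wedge l_1\wedge\dots\wedge l_m$ with literals $l_i$ (xor-assumptions) viewed as unary xor-clauses. Inference rules, for a variable $x$ occurring in the xor-clause $C$: from $x$ and $C$ derive $C[x/\top]$; from $x\oplus\top$ and $C$ derive $C[x/\bot]$. A UP-derivation on $\psi$ is a finite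 directed acyclic graph $\langle V,E,L\rangle$ with xor-clause labels $L(v)$, each vertex either being an input vertex (no incoming edges, label in $\psi$) or having two incoming edges from $v_1,v_2$ with $L(v)$ derived from $L(v_1),L(v_2)$ by a rule. A cut for a non-input vertex $v$ is a partition $W=(V_a,V_b)$ of $V$ with $v\in V_b$ and with every input vertex having a path to $v$ in $V_a$. $\operatorname{reasons}(W)=\{u\in V_a\mid L(u)\notin\phi_{\mathrm{xor}},\ \exists u'\in V_b:\langle u,u'\rangle\in E\}$; $W$ is cnf-compatible if all labels of vertices in $\operatorname{reasons}(W)$ are unary. **Explanations.** Let $v$ be a vertex with $L(v)=\hat l$ a literal and $W$ a cnf-compatible cut for $v$. The implicative explanation gives the implying or-clause $(\bigwedge_{u\in\operatorname{reasons}(W)}L(u))\Rightarrow\hat l$. The parity explanation is $\mathit{Expl}_\oplus(v,W)=f_W(v)$, where $f_W(u)=\top$ if $u$ is an input node with $L(u)\in\phi_{\mathrm{xor}}$; $f_W(u)=L(u)$ if $u$ is an input node labeled with an xor-assumption or a non-input node in $V_a$; and $f_W(u)=f_W(u_1)\oplus f_W(u_2)\oplus\top$ if $u$ is a non-input node in $V_b$ with incoming edges from $u_1,u_2$. It gives the implying or-clause $(\bigwedge_{u\in S}L(u))\Rightarrow\hat l$, where $S=\{u\in\operatorname{reasons}(W)\mid\operatorname{vars}(L(u))\subseteq\operatorname{vars}(\mathit{Expl}_\oplus(v,W))\}$ and $\operatorname{vars}$ denotes the set of variables occurring in a clause. **DPLL(XOR) with the UP-module.** A conflict-driven clause learning (CDCL)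 SAT solver searches for a satisfying assignment of $\phi$, maintaining a sequence $\pi$ of literals. It repeatedly (1) applies unit propagation on $\phi_{\mathrm{or}}$ and the learned or-clauses; (2) if there is no conflict, passes the newly assigned literals to the UP-module as xor-assumptions; the module returns the UP-derivable literals on $\phi_{\mathrm{xor}}$ and the xor-assumptions as xor-implied literals, each xor-implied literal $\hat l$ with an implying or-clause obtained from a cnf-compatible cut $W$ for a vertex $v$ with $L(v)=\hat l$ in a UP-derivation (namely $(\bigwedge_{u\in\operatorname{reasons}(W)}L(u))\Rightarrow\hat l$ if only implicative explanations are used, and either this or-clause or $(\bigwedge_{u\in S}L(u))\Rightarrow\hat l$ with $S=\{u\in\operatorname{reasons}(W)\mid\operatorname{vars}(L(u))\subseteq\operatorname{vars}(\mathit{Expl}_\oplus(v,W))\}$ if parity explanations are allowed) and whose left-hand side literals are xor-assumptions made or xor-implied literals returned earlier; a new xor-implied literal is added to $\pi$ with its implying or-clause; if a returned literal is $\bot$ or its negation is already in $\pi$, its implying or-clause is a conflict clause; (3) if there is a conflict, performs standard Boolean conflict analysis on the implying clauses, learns a conflict or-clause and backjumps (retracting xor-assumptions accordingly), or returns "unsatisfiable" if backjumping is not possible; (4) otherwise, if no further propagation applies, adds a freely chosen unassigned decision literal to $\pi$ (or returns "satisfiable" if none exists). The xor-clause part $\phi_{\mathrm{xor}}$ is not modified during the run. A DPLL(XOR) proof of unsatisfiability of $\phi$ is a run, for some choice of the free choices (decisions, cuts, learned conflict clauses, etc., as available to a CDCL solver), that returns "unsatisfiable"; its size is the total size of the run (assignments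 made and clauses produced). -}

module Defs where

open import Data.Bool using (Bool; true; false; not; _xor_; if_then_else_)
open import Data.Bool.Properties using () renaming (_≟_ to _≟ᵇ_)
open import Data.Fin using (Fin; zero; suc)
open import Data.Fin.Properties using () renaming (_≟_ to _≟ᶠ_)
open import Data.Fin.Subset using (Subset; inside; outside; ⁅_⁆; ∣_∣; _∩_)
  renaming (_∈_ to _∈ˢ_; _∉_ to _∉ˢ_; _⊆_ to _⊆ˢ_; ⊥ to ∅; _-_ to _-ˢ_)
open import Data.Fin.Subset.Properties using () renaming (_∈?_ to _∈ˢ?_)
open import Data.List using (List; []; _∷_; _++_; map; filter; deduplicate; foldr; length)
import Data.List.Membership.DecPropositional as DecMembership
open import Data.List.Membership.Propositional using (_∈_; _∉_)
open import Data.List.Relation.Unary.All using (All)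
open import Data.List.Relation.Unary.Any using (Any)
open import Data.Nat using (ℕ; _+_; _*_; _%_; _≤_)
open import Data.Nat.ListAction using (sum)
open import Data.Product using (Σ; ∃; _×_; _,_)
open import Data.Product.Properties using (≡-dec)
open import Data.Sum using (_⊎_)
open import Data.Vec using (Vec; []; _∷_; lookup; tail; zipWith)
open import Data.Vec.Properties using () renaming (≡-dec to ≡-decᵛ)
import Data.Vec as Vec
open import Function using (Injective; _⇔_)
open import Level using (0ℓ)
open import Relation.Binary using (DecidableEquality)
open import Relation.Binary.Construct.Closure.ReflexiveTransitive using (Star)
open import Relation.Binary.PropositionalEquality using (_≡_; _≢_)
open import Relation.Nullary using (¬_; ¬?; does)
open import Relation.Unary using (Pred)

-- The constant ⊤ is the atom zero; the variables are the successors.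
Atom : ℕ → Set
Atom n = Fin (ℕ.suc n)

pattern topₐ  = zero
pattern var x = suc x

Literal : ℕ → Set
Literal n = Bool × Atom n

pattern pos a = true  , a
pattern neg a = false , a

infix 9 ~_

~_ : ∀ {n} → Literal n → Literal n
~ (b , a) = not b , a

infix 4 _≟ˡ_ _≟ˣ_

_≟ˡ_ : ∀ {n} → DecidableEquality (Literal n)
_≟ˡ_ = ≡-dec _≟ᵇ_ _≟ᶠ_

OrClause : ℕ → Set
OrClause n = List (Literal n)

-- Xor-clauses in normal form: the set of the atoms that occur.
-- Propositional equality is therefore equality of normal forms.
XorClause : ℕ → Set
XorClause n = Subset (ℕ.suc n)

_≟ˣ_ : ∀ {n} → DecidableEquality (XorClause n)
_≟ˣ_ = ≡-decᵛ _≟ᵇ_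

infixl 6 _⊕_

_⊕_ : ∀ {n} → XorClause n → XorClause n → XorClause n
_⊕_ = zipWith _xor_

⊤ˣ ⊥ˣ : ∀ {n} → XorClause n
⊤ˣ = ⁅ topₐ ⁆
⊥ˣ = ∅

_[_/_] : ∀ {n} → XorClause n → Atom n → XorClause n → XorClause n
C [ a / D ] = if does (a ∈ˢ? C) then (C -ˢ a) ⊕ D else C

-- A literal viewed as an xor-clause; in particular ⟦ neg topₐ ⟧ is ⊥ˣ.
⟦_⟧ : ∀ {n} → Literal n → XorClause n
⟦ pos a ⟧ = ⁅ a ⁆
⟦ neg a ⟧ = ⁅ a ⁆ ⊕ ⊤ˣ

Unary : ∀ {n} → XorClause n → Set
Unary C = ∃ λ b → ∃ λ x → C ≡ ⟦ b , var x ⟧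

infix 4 _vars⊆_

_vars⊆_ : ∀ {n} → XorClause n → XorClause n → Set
C vars⊆ D = tail C ⊆ˢ tail D

record CnfXor (n : ℕ) : Set where
  constructor _∧_
  field
    orPart  : List (OrClause n)
    xorPart : List (XorClause n)

open CnfXor public

Formula : Set
Formula = ∃ CnfXor

xorLength : ∀ {n} → XorClause n → ℕ
xorLength C = ℕ.suc ∣ C ∣

formulaLength : Formula → ℕ
formulaLength (_ , φ) =
  sum (map (λ C → ℕ.suc (length C)) (orPart φ)) + sum (map xorLength (xorPart φ))

-- An assignment is the set of the variables that are true.
Assignment : ℕ → Set
Assignment n = Subset n

trueAtoms : ∀ {n} → Assignment n → Subset (ℕ.suc n)
trueAtoms ν = inside ∷ ν

infix 4 _⊨ˡ_ _⊨ˣ_ _⊨_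

_⊨ˡ_ : ∀ {n} → Assignment n → Literal n → Set
ν ⊨ˡ (b , a) = lookup (trueAtoms ν) a ≡ b

_⊨ˣ_ : ∀ {n} → Assignment n → XorClause n → Set
ν ⊨ˣ C = ∣ C ∩ trueAtoms ν ∣ % 2 ≡ 1

_⊨_ : ∀ {n} → Assignment n → CnfXor n → Set
ν ⊨ φ = All (Any (ν ⊨ˡ_)) (orPart φ) × All (ν ⊨ˣ_) (xorPart φ)

Unsatisfiable : Formula → Set
Unsatisfiable (n , φ) = ¬ (∃ λ (ν : Assignment n) → ν ⊨ φ)

infix 4 _,_⊢_

data _,_⊢_ {n} : XorClause n → XorClause n → XorClause n → Set where
  ⊕-unit⁺ : ∀ {x C} → var x ∈ˢ C → ⟦ pos (var x) ⟧ , C ⊢ (C [ var x / ⊤ˣ ])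
  ⊕-unit⁻ : ∀ {x C} → var x ∈ˢ C → ⟦ neg (var x) ⟧ , C ⊢ (C [ var x / ⊥ˣ ])

-- UP-derivations on Φ ∧ A, for xor-clauses Φ and xor-assumptions A.
-- A finite acyclic graph is listed in a topological order, latest vertex
-- first: the vertices are Fin k, labelled by a vector, and each new vertex
-- (zero) points back into the graph already built (suc).
data UPDerivation {n} (Φ : List (XorClause n)) (A : List (Literal n)) :
                  ∀ {k} → Vec (XorClause n) k → Set where
  empty   : UPDerivation Φ A []
  input   : ∀ {k C} {L : Vec (XorClause n) k} →
            UPDerivation Φ A L →
            C ∈ Φ ++ map ⟦_⟧ A →
            UPDerivation Φ A (C ∷ L)
  derived : ∀ {k C} {L : Vec (XorClause n) k} →
            UPDerivation Φ A L →
            (u₁ u₂ : Fin k) → u₁ ≢ u₂ →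
            lookup L u₁ , lookup L u₂ ⊢ C →
            UPDerivation Φ A (C ∷ L)

UPDerivable : ∀ {n} → List (XorClause n) → List (Literal n) → Literal n → Set
UPDerivable {n} Φ A l =
  ∃ λ k → Σ (Vec (XorClause n) k) λ L →
    UPDerivation Φ A L × ∃ λ v → lookup L v ≡ ⟦ l ⟧

module _ {n} {Φ : List (XorClause n)} {A : List (Literal n)} where

  data Edge : ∀ {k} {L : Vec (XorClause n) k} →
              UPDerivation Φ A L → Fin k → Fin k → Set where
    edge₁  : ∀ {k} {L : Vec (XorClause n) k} {D : UPDerivation Φ A L} {C u₁ u₂ u₁≢u₂ r} →
             Edge (derived {C = C} D u₁ u₂ u₁≢u₂ r) (suc u₁) zero
    edge₂  : ∀ {k} {L : Vec (XorClause n) k} {D : UPDerivation Φ A L} {C u₁ u₂ u₁≢u₂ r} →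
             Edge (derived {C = C} D u₁ u₂ u₁≢u₂ r) (suc u₂) zero
    input↑ : ∀ {k} {L : Vec (XorClause n) k} {D : UPDerivation Φ A L} {C i u w} →
             Edge D u w → Edge (input {C = C} D i) (suc u) (suc w)
    deriv↑ : ∀ {k} {L : Vec (XorClause n) k} {D : UPDerivation Φ A L} {C u₁ u₂ u₁≢u₂ r u w} →
             Edge D u w → Edge (derived {C = C} D u₁ u₂ u₁≢u₂ r) (suc u) (suc w)

  module _ {k} {L : Vec (XorClause n) k} (D : UPDerivation Φ A L) where

    IsInput : Fin k → Set
    IsInput u = ∀ w → ¬ Edge D w u

    -- A partition (Vₐ , V_b) is given by Vₐ; V_b is its complement.
    record IsCut (Vₐ : Subset k) (v : Fin k) : Set where
      field
        nonInput : ∃ λ w → Edge D w v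
        v∈V_b    : v ∉ˢ Vₐ
        inputs   : ∀ u → IsInput u → Star (Edge D) u v → u ∈ˢ Vₐ

    Reasons : Subset k → Pred (Fin k) 0ℓ
    Reasons Vₐ u = u ∈ˢ Vₐ × lookup L u ∉ Φ × ∃ λ w → w ∉ˢ Vₐ × Edge D u w

    CnfCompatible : Subset k → Set
    CnfCompatible Vₐ = ∀ u → Reasons Vₐ u → Unary (lookup L u)

  -- The function f_W, for W given by Vₐ.
  parityExpl : ∀ {k} {L : Vec (XorClause n) k} →
               UPDerivation Φ A L → Subset k → Fin k → XorClause n
  parityExpl {L = C ∷ _} (input D _) _ zero = if does (C ∈? Φ) then ⊤ˣ else C
    where open DecMembership _≟ˣ_ using (_∈?_)
  parityExpl {L = C ∷ _} (derived D u₁ u₂ _ _) (inside  ∷ W) zero = C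
  parityExpl             (derived D u₁ u₂ _ _) (outside ∷ W) zero =
    parityExpl D W u₁ ⊕ parityExpl D W u₂ ⊕ ⊤ˣ
  parityExpl (input D _)         (_ ∷ W) (suc u) = parityExpl D W u
  parityExpl (derived D _ _ _ _) (_ ∷ W) (suc u) = parityExpl D W u

  ParityReasons : ∀ {k} {L : Vec (XorClause n) k} →
                  UPDerivation Φ A L → Subset k → Fin k → Pred (Fin k) 0ℓ
  ParityReasons {L = L} D Vₐ v u =
    Reasons D Vₐ u × lookup L u vars⊆ parityExpl D Vₐ v

data Explanations : Set where
  implicativeOnly parityAllowed : Explanations

-- As a set, ls consists of the literals labelling the vertices in P.
infix 4 _ListsLabels_Of_

_ListsLabels_Of_ : ∀ {n k} → List (Literal n) → Pred (Fin k) 0ℓ → Vec (XorClause n) k → Set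
ls ListsLabels P Of L = ∀ l → l ∈ ls ⇔ (∃ λ u → P u × lookup L u ≡ ⟦ l ⟧)

derivationSize : ∀ {n k} → Vec (XorClause n) k → ℕ
derivationSize L = Vec.sum (Vec.map xorLength L)

implyingClause : ∀ {n} → List (Literal n) → Literal n → OrClause n
implyingClause ls l = l ∷ map ~_ ls

-- Implies e Φ A ls l s: the UP-module may return l with the implying
-- or-clause ⋀ ls ⇒ l, read off from a UP-derivation of size s.
data Implies {n} (Φ : List (XorClause n)) (A : List (Literal n)) :
             Explanations → List (Literal n) → Literal n → ℕ → Set where

  -- Input vertices have no cuts; a conjunct of Φ needs no premises.
  given : ∀ {e l} → ⟦ l ⟧ ∈ Φ → Implies Φ A e [] l (xorLength ⟦ l ⟧)

  implicative : ∀ {e k v l ls} {L : Vec (XorClause n) k} {Vₐ : Subset k} →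
    (D : UPDerivation Φ A L) →
    lookup L v ≡ ⟦ l ⟧ →
    IsCut D Vₐ v →
    CnfCompatible D Vₐ →
    ls ListsLabels Reasons D Vₐ Of L →
    All (_∈ A) ls →
    Implies Φ A e ls l (derivationSize L)

  -- Dropping the reasons outside S is sound only if cancelled variables
  -- really cancel.  This fails if reasons(W) has complementary labels, which
  -- is excluded by asking all of reasons(W) to be known literals, or if a
  -- non-input vertex of Vₐ repeats a clause of Φ: it is not a reason,
  -- although f_W does not map it to ⊤.
  parity : ∀ {k v l rs ls} {L : Vec (XorClause n) k} {Vₐ : Subset k} →
    (D : UPDerivation Φ A L) →
    lookup L v ≡ ⟦ l ⟧ →
    IsCut D Vₐ v →
    CnfCompatible D Vₐ →
    rs ListsLabels Reasons D Vₐ Of L →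
    All (_∈ A) rs →
    (∀ u → u ∈ˢ Vₐ → lookup L u ∈ Φ → IsInput D u) →
    ls ListsLabels ParityReasons D Vₐ v Of L →
    Implies Φ A parityAllowed ls l (derivationSize L)

data Entry (n : ℕ) : Set where
  decision : Literal n → Entry n
  implied  : Literal n → OrClause n → Entry n

literal : ∀ {n} → Entry n → Literal n
literal (decision l)  = l
literal (implied l _) = l

data IsImplied {n} : Entry n → Set where
  isImplied : ∀ {l C} → IsImplied (implied l C)

-- Latest entry first.
Trail : ℕ → Set
Trail n = List (Entry n)

lits : ∀ {n} → Trail n → List (Literal n)
lits = map literal

module _ {n} (π : Trail n) where

  IsTrue IsFalse Unassigned : Literal n → Set
  IsTrue l     = l ≡ pos topₐ ⊎ l ∈ lits π
  IsFalse l    = IsTrue (~ l)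
  Unassigned l = ¬ IsTrue l × ¬ IsFalse l

  Falsified : OrClause n → Set
  Falsified C = All IsFalse C

  UnitWith : Literal n → OrClause n → Set
  UnitWith l C = l ∈ C × Unassigned l × (∀ k → k ∈ C → k ≢ l → IsFalse k)

  OrSaturated : List (OrClause n) → Set
  OrSaturated Γ = ∀ C → C ∈ Γ → ¬ Falsified C × (∀ l → ¬ UnitWith l C)

  XorSaturated : List (XorClause n) → Set
  XorSaturated Φ = ∀ l → UPDerivable Φ (lits π) l → IsTrue l

resolvent : ∀ {n} → Literal n → OrClause n → OrClause n → OrClause n
resolvent l K C = deduplicate _≟ˡ_ ((K ∖ (~ l)) ++ (C ∖ l))
  where
  _∖_ : OrClause _ → Literal _ → OrClause _
  C ∖ l = filter (λ k → ¬? (k ≟ˡ l)) C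

-- A state carries π and the learned or-clauses; `clausal` is unit propagation
-- on or-clauses, `xorModule` a call to the UP-module (whose xor-assumptions
-- are the literals of π), `conflict` the analysis of a conflict clause.
data State (n : ℕ) : Set where
  clausal xorModule : Trail n → List (OrClause n) → State n
  conflict          : Trail n → List (OrClause n) → OrClause n → State n
  unsatisfiable     : State n

-- Step e φ s c t: one step of a run from s to t, of size c.
data Step {n} (e : Explanations) (φ : CnfXor n) : State n → ℕ → State n → Set where

  propagate : ∀ {π Λ C l} →
    C ∈ orPart φ ++ Λ → UnitWith π l C →
    Step e φ (clausal π Λ) 1 (clausal (implied l C ∷ π) Λ)

  orConflict : ∀ {π Λ C} →
    C ∈ orPart φ ++ Λ → Falsified π C →
    Step e φ (clausal π Λ) 1 (conflict π Λ C)

  callModule : ∀ {π Λ} →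
    OrSaturated π (orPart φ ++ Λ) →
    Step e φ (clausal π Λ) 1 (xorModule π Λ)

  xorImplied : ∀ {π Λ ls l s} →
    Implies (xorPart φ) (lits π) e ls l s → Unassigned π l →
    let C = implyingClause ls l in
    Step e φ (xorModule π Λ) (1 + length C + s) (xorModule (implied l C ∷ π) Λ)

  xorConflict : ∀ {π Λ ls l s} →
    Implies (xorPart φ) (lits π) e ls l s → IsFalse π l →
    let C = implyingClause ls l in
    Step e φ (xorModule π Λ) (1 + length C + s) (conflict π Λ C)

  moduleDone : ∀ {π Λ} →
    XorSaturated π (xorPart φ) →
    Step e φ (xorModule π Λ) 1 (clausal π Λ)

  decide : ∀ {π Λ l} →
    XorSaturated π (xorPart φ) → OrSaturated π (orPart φ ++ Λ) → Unassigned π l →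
    Step e φ (xorModule π Λ) 1 (clausal (decision l ∷ π) Λ)

  resolve : ∀ {π Λ K C l} →
    implied l C ∈ π → ~ l ∈ K →
    Step e φ (conflict π Λ K) (1 + length (resolvent l K C)) (conflict π Λ (resolvent l K C))

  -- Back to before some decision, where the learned clause becomes unit.
  backjump : ∀ {π π₂ d π₁ Λ K l} →
    π ≡ π₂ ++ decision d ∷ π₁ → UnitWith π₁ l K →
    Step e φ (conflict π Λ K) (1 + length K) (clausal π₁ (K ∷ Λ))

  -- No backjump helps: the conflict persists without any decisions.
  returnUnsat : ∀ {π π₂ π₁ Λ K} →
    π ≡ π₂ ++ π₁ → All IsImplied π₁ → Falsified π₁ K →
    Step e φ (conflict π Λ K) 1 unsatisfiable

infixr 5 _◅_

data Run {n} (e : Explanations) (φ : CnfXor n) : State n → ℕ → State n → Set where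
  stop : ∀ {s} → Run e φ s 0 s
  _◅_  : ∀ {s t u c d} → Step e φ s c t → Run e φ t d u → Run e φ s (c + d) u

HasProofOfSize≤ : Explanations → Formula → ℕ → Set
HasProofOfSize≤ e (_ , φ) b =
  ∃ λ size → Run e φ (clausal [] []) size unsatisfiable × size ≤ b

Infinite : Pred Formula 0ℓ → Set
Infinite 𝓕 = ∃ λ (f : ℕ → Formula) → Injective _≡_ _≡_ f × (∀ i → 𝓕 (f i))

-- Coefficients, lowest degree first.  Natural coefficients suffice for
-- upper bounds.
Polynomial : Set
Polynomial = List ℕ

eval : Polynomial → ℕ → ℕ
eval p x = foldr (λ a r → a + x * r) 0 p

PolynomialProofs : Explanations → Pred Formula 0ℓ → Set
PolynomialProofs e 𝓕 =
  ∃ λ (p : Polynomial) → ∀ φ → 𝓕 φ → HasProofOfSize≤ e φ (eval p (formulaLength φ))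

module Submission where

-- The formulas consist of the two xor-clauses x₁ ⊕ ⋯ ⊕ xₙ and x₁ ⊕ ⋯ ⊕ xₙ ⊕ ⊤
-- with n = 2 m.  After n − 1 decisions the UP-module derives ⊥ from both; in
-- the parity explanation all the assumptions cancel, so the conflict clause is
-- ⊥ and the run ends at once.  An implicative explanation, in contrast,
-- mentions at least n − 1 variables.  It therefore excludes at most one of the
-- 2 ^ m assignments with x₁ = x₂, x₃ = x₄, …, as two of these differ in at
-- least two variables.  An assignment excluded by no implying clause satisfies
-- every clause of the run and thus prevents the final conflict, so a run has
-- size at least 2 ^ m.

open import Defs
open import Algebra.Bundles using (CommutativeRing; CommutativeSemigroup)
import Algebra.Properties.CommutativeSemigroup as CommutativeSemigroupProperties
open import Data.Bool using (Bool; true; false; _xor_; if_then_else_)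
  renaming (_∧_ to _∧ᵇ_)
open import Data.Bool.Properties
  using (xor-assoc; xor-comm; xor-identityˡ; xor-identityʳ; xor-same; xor-∧-commutativeRing;
         ∧-distribʳ-xor; ¬-not; not-¬)
  renaming (_≟_ to _≟ᵇ_)
open import Data.Empty using (⊥; ⊥-elim)
open import Data.Fin using (Fin; zero; suc; _>_)
open import Data.Fin.Induction using (>-wellFounded)
open import Data.Fin.Properties using (suc-injective)
open import Data.Fin.Subset using (Subset; inside; outside; ⁅_⁆; ∣_∣; _∩_)
  renaming (_∈_ to _∈ˢ_; _∉_ to _∉ˢ_; ⊥ to ∅; ⊤ to full; _-_ to _-ˢ_)
open import Data.Fin.Subset.Properties
  using (x∈⁅x⁆; x∈⁅y⁆⇒x≡y; p─⊥≡p; ∉⊥; ∈⊤; drop-there; ∣p∣≤n; ∣⊤∣≡n)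
  renaming (_∈?_ to _∈ˢ?_)
open import Data.List using (List; []; _∷_; _++_; map; filter; length; allFin)
import Data.List.Membership.DecPropositional as DecMembership
open import Data.List.Membership.Propositional using (_∈_; _∉_)
open import Data.List.Membership.Propositional.Properties
  using (∈-map⁺; ∈-map⁻; ∈-++⁺ˡ; ∈-++⁺ʳ; ∈-++⁻; ∈-filter⁺; ∈-filter⁻;
         ∈-deduplicate⁺; ∈-allFin)
open import Data.List.Properties
  using (filter-all; length-++; length-map; length-tabulate; ++-identityʳ)
open import Data.List.Relation.Unary.All using (All; []; _∷_)
import Data.List.Relation.Unary.All as All
import Data.List.Relation.Unary.All.Properties as All
open import Data.List.Relation.Unary.AllPairs using ([]; _∷_)
open import Data.List.Relation.Unary.Any using (Any; here; there; any?)
import Data.List.Relation.Unary.Any as Any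
open import Data.List.Relation.Unary.Unique.Propositional using (Unique)
import Data.List.Relation.Unary.Unique.Propositional.Properties as Unique
open import Data.Nat
  using (ℕ; zero; suc; pred; _+_; _*_; _^_; _%_; _≤_; _<_; z≤n; s≤s; NonZero)
open import Data.Nat.DivMod using ([m+n]%n≡m%n)
open import Data.Nat.ListAction using (sum)
open import Data.Nat.Properties hiding (suc-injective)
open import Data.Nat.Solver using (module +-*-Solver)
open import Data.Product using (∃; ∃₂; _×_; _,_; proj₁; proj₂)
open import Data.Sum using (_⊎_; inj₁; inj₂; [_,_]′)
open import Data.Vec using (Vec; []; _∷_; lookup; zipWith; replicate)
import Data.Vec as Vec
open import Data.Vec.Properties
  using (zipWith-assoc; zipWith-comm; zipWith-identityˡ; zipWith-identityʳ;
         lookup-zipWith; lookup-replicate; []=⇒lookup; lookup⇒[]=; ∷-injectiveʳ)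
open import Function using (_∘_; id; Equivalence; mk⇔)
open import Induction.WellFounded using (Acc; acc)
open import Level using (0ℓ)
open import Relation.Binary.Construct.Closure.ReflexiveTransitive using (Star; ε; _◅_)
open import Relation.Binary.PropositionalEquality hiding ([_])
open import Relation.Nullary using (¬_; ¬?; Dec; yes; no; contradiction; does; decidable-stable)
open import Relation.Nullary.Decidable using (dec-true)
open import Relation.Unary using (Pred; Decidable)

-- Algebra of xor-clauses and membership of variables.

⊕-assoc : ∀ {n} (p q r : XorClause n) → (p ⊕ q) ⊕ r ≡ p ⊕ (q ⊕ r)
⊕-assoc = zipWith-assoc xor-assoc

⊕-comm : ∀ {n} (p q : XorClause n) → p ⊕ q ≡ q ⊕ p
⊕-comm = zipWith-comm xor-comm

⊕-self : ∀ {n} (p : XorClause n) → p ⊕ p ≡ ⊥ˣ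
⊕-self p = go p
  where
  go : ∀ {k} (p : Vec Bool k) → zipWith _xor_ p p ≡ replicate k false
  go []      = refl
  go (b ∷ p) = cong₂ _∷_ (xor-same b) (go p)

⊕-identityʳ : ∀ {n} (p : XorClause n) → p ⊕ ⊥ˣ ≡ p
⊕-identityʳ = zipWith-identityʳ xor-identityʳ

⊕-identityˡ : ∀ {n} (p : XorClause n) → ⊥ˣ ⊕ p ≡ p
⊕-identityˡ = zipWith-identityˡ xor-identityˡ

⊕-commutativeSemigroup : ℕ → CommutativeSemigroup 0ℓ 0ℓ
⊕-commutativeSemigroup n = record
  { Carrier = XorClause n
  ; isCommutativeSemigroup = record
    { isSemigroup = record
      { isMagma = record { isEquivalence = isEquivalence ; ∙-cong = cong₂ _⊕_ }
      ; assoc = ⊕-assoc }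
    ; comm = ⊕-comm }
  }

⊕-cancelʳ : ∀ {n} (p q r : XorClause n) → (p ⊕ r) ⊕ (q ⊕ r) ≡ p ⊕ q
⊕-cancelʳ {n} p q r = begin
  (p ⊕ r) ⊕ (q ⊕ r) ≡⟨ interchange p r q r ⟩
  (p ⊕ q) ⊕ (r ⊕ r) ≡⟨ cong ((p ⊕ q) ⊕_) (⊕-self r) ⟩
  (p ⊕ q) ⊕ ⊥ˣ      ≡⟨ ⊕-identityʳ _ ⟩
  p ⊕ q             ∎
  where
  open ≡-Reasoning
  open CommutativeSemigroupProperties (⊕-commutativeSemigroup n) using (interchange)

lookup-⊕ : ∀ {n} (p q : XorClause n) a → lookup (p ⊕ q) a ≡ lookup p a xor lookup q a
lookup-⊕ p q a = lookup-zipWith _xor_ a p q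

∉⇒lookup : ∀ {n} {p : Subset n} {i} → i ∉ˢ p → lookup p i ≡ false
∉⇒lookup i∉p = ¬-not (i∉p ∘ lookup⇒[]= _ _)

var∉⊤ˣ : ∀ {n} {x : Fin n} → var x ∉ˢ ⊤ˣ
var∉⊤ˣ x∈ = ∉⊥ (drop-there x∈)

lookup-⟦⟧ : ∀ {n} b a (x : Fin n) → lookup ⟦ b , a ⟧ (var x) ≡ lookup ⁅ a ⁆ (var x)
lookup-⟦⟧ true  a x = refl
lookup-⟦⟧ false a x = begin
  lookup (⁅ a ⁆ ⊕ ⊤ˣ) (var x)            ≡⟨ lookup-⊕ ⁅ a ⁆ ⊤ˣ (var x) ⟩
  lookup ⁅ a ⁆ (var x) xor lookup ∅ x
    ≡⟨ cong (lookup ⁅ a ⁆ (var x) xor_) (lookup-replicate x false) ⟩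
  lookup ⁅ a ⁆ (var x) xor false         ≡⟨ xor-identityʳ _ ⟩
  lookup ⁅ a ⁆ (var x)                   ∎
  where open ≡-Reasoning

∈⟦⟧⁺ : ∀ {n} b (x : Fin n) → var x ∈ˢ ⟦ b , var x ⟧
∈⟦⟧⁺ b x = lookup⇒[]= _ ⟦ b , var x ⟧ (trans (lookup-⟦⟧ b (var x) x) ([]=⇒lookup (x∈⁅x⁆ (var x))))

∈⟦⟧⁻ : ∀ {n} b a {x : Fin n} → var x ∈ˢ ⟦ b , a ⟧ → var x ≡ a
∈⟦⟧⁻ b a {x} x∈ =
  x∈⁅y⁆⇒x≡y a (lookup⇒[]= _ ⁅ a ⁆ (trans (sym (lookup-⟦⟧ b a x)) ([]=⇒lookup x∈)))

⟦⟧-distinct : ∀ {n} b a {x y : Fin n} → x ≢ y → var x ∈ˢ ⟦ b , a ⟧ → var y ∉ˢ ⟦ b , a ⟧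
⟦⟧-distinct b a x≢y x∈ y∈ =
  x≢y (suc-injective (trans (∈⟦⟧⁻ b a x∈) (sym (∈⟦⟧⁻ b a y∈))))

-- The inference rules as sums of xor-clauses.

∈⇒-≡⊕ : ∀ {k} {C : Subset k} {a} → a ∈ˢ C → C -ˢ a ≡ zipWith _xor_ C ⁅ a ⁆
∈⇒-≡⊕ {C = true ∷ C}  {zero}  Vec.here =
  cong (false ∷_) (trans (p─⊥≡p C) (sym (zipWith-identityʳ xor-identityʳ C)))
∈⇒-≡⊕ {C = b ∷ C} {suc a} (Vec.there a∈C) = cong₂ _∷_ (sym (xor-identityʳ b)) (∈⇒-≡⊕ a∈C)

[/]≡⊕ : ∀ {n} {C : XorClause n} {a} D → a ∈ˢ C → C [ a / D ] ≡ C ⊕ ⁅ a ⁆ ⊕ D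
[/]≡⊕ {C = C} {a} D a∈C rewrite dec-true (a ∈ˢ? C) a∈C = cong (_⊕ D) (∈⇒-≡⊕ a∈C)

⊕⊤⊕⊤ : ∀ {n} (C p : XorClause n) → C ⊕ (p ⊕ ⊤ˣ) ⊕ ⊤ˣ ≡ C ⊕ p ⊕ ⊥ˣ
⊕⊤⊕⊤ C p = begin
  C ⊕ (p ⊕ ⊤ˣ) ⊕ ⊤ˣ    ≡⟨ cong (_⊕ ⊤ˣ) (⊕-assoc C p ⊤ˣ) ⟨
  C ⊕ p ⊕ ⊤ˣ ⊕ ⊤ˣ      ≡⟨ ⊕-assoc (C ⊕ p) ⊤ˣ ⊤ˣ ⟩
  C ⊕ p ⊕ (⊤ˣ ⊕ ⊤ˣ)    ≡⟨ cong (C ⊕ p ⊕_) (⊕-self ⊤ˣ) ⟩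
  C ⊕ p ⊕ ⊥ˣ           ∎
  where open ≡-Reasoning

-- Replacing `x` by `⊤` adds `x ⊕ ⊤`, and replacing it by `⊥` adds `x`, which is `(x ⊕ ⊤) ⊕ ⊤`. So
-- both rules add the unary premise and `⊤` to the other premise, whatever the sign.
⊢-⊕⁺ : ∀ {n} b {x : Fin n} {C} → var x ∈ˢ C → ⟦ b , var x ⟧ , C ⊢ (C ⊕ ⟦ b , var x ⟧ ⊕ ⊤ˣ)
⊢-⊕⁺ true  {x} {C} x∈C = subst (⟦ pos (var x) ⟧ , C ⊢_) ([/]≡⊕ ⊤ˣ x∈C) (⊕-unit⁺ x∈C)
⊢-⊕⁺ false {x} {C} x∈C =
  subst (⟦ neg (var x) ⟧ , C ⊢_)
        (trans ([/]≡⊕ ⊥ˣ x∈C) (sym (⊕⊤⊕⊤ C ⁅ var x ⁆)))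
        (⊕-unit⁻ x∈C)

data Resolves {n} (C₁ C₂ : XorClause n) : XorClause n → Set where
  resolves : ∀ b x → C₁ ≡ ⟦ b , var x ⟧ → var x ∈ˢ C₂ → Resolves C₁ C₂ (C₂ ⊕ C₁ ⊕ ⊤ˣ)

⊢-⊕⁻ : ∀ {n} {C₁ C₂ C : XorClause n} → C₁ , C₂ ⊢ C → Resolves C₁ C₂ C
⊢-⊕⁻ (⊕-unit⁺ {x} {C} x∈C) =
  subst (Resolves _ C) (sym ([/]≡⊕ ⊤ˣ x∈C)) (resolves true x refl x∈C)
⊢-⊕⁻ (⊕-unit⁻ {x} {C} x∈C) =
  subst (Resolves _ C) (trans (⊕⊤⊕⊤ C ⁅ var x ⁆) (sym ([/]≡⊕ ⊥ˣ x∈C)))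
        (resolves false x refl x∈C)

-- Of all variables, the added summands contain only `x`, so a rule eliminates no other one.
∈-resolvent : ∀ {n} b {x y : Fin n} {C} → y ≢ x → var y ∈ˢ C →
              var y ∈ˢ (C ⊕ ⟦ b , var x ⟧ ⊕ ⊤ˣ)
∈-resolvent b {x} {y} {C} y≢x y∈C = lookup⇒[]= _ (C ⊕ ⟦ b , var x ⟧ ⊕ ⊤ˣ) (begin
  lookup (C ⊕ ⟦ b , var x ⟧ ⊕ ⊤ˣ) (var y)
    ≡⟨ lookup-⊕ (C ⊕ ⟦ b , var x ⟧) ⊤ˣ (var y) ⟩
  lookup (C ⊕ ⟦ b , var x ⟧) (var y) xor lookup ∅ y
    ≡⟨ cong₂ _xor_ (lookup-⊕ C ⟦ b , var x ⟧ (var y)) (lookup-replicate y false) ⟩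
  (lookup C (var y) xor lookup ⟦ b , var x ⟧ (var y)) xor false
    ≡⟨ xor-identityʳ _ ⟩
  lookup C (var y) xor lookup ⟦ b , var x ⟧ (var y)
    ≡⟨ cong₂ _xor_ ([]=⇒lookup y∈C) (∉⇒lookup (y≢x ∘ suc-injective ∘ ∈⟦⟧⁻ b (var x))) ⟩
  true ∎)
  where open ≡-Reasoning

-- Invariants of derivations and of cuts.

module _ {n} {Φ : List (XorClause n)} {A : List (Literal n)} where

  -- Vertices are numbered latest first, so edges lead to smaller indices; recording this makes
  -- walks against the edges well-founded.
  data Vertex {k} {L : Vec (XorClause n) k} (D : UPDerivation Φ A L) (u : Fin k) : Set where
    isInput : IsInput D u → Vertex D u
    isDerived : ∀ {u₁ u₂} → u₁ > u → u₂ > u → Edge D u₁ u → Edge D u₂ u →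
                lookup L u₁ , lookup L u₂ ⊢ lookup L u → Vertex D u

  vertex : ∀ {k} {L : Vec (XorClause n) k} (D : UPDerivation Φ A L) u → Vertex D u
  vertex (input D i) zero = isInput λ _ ()
  vertex (input D i) (suc u) with vertex D u
  ... | isInput noEdge               = isInput λ { _ (input↑ e) → noEdge _ e }
  ... | isDerived u₁>u u₂>u e₁ e₂ r = isDerived (s≤s u₁>u) (s≤s u₂>u) (input↑ e₁) (input↑ e₂) r
  vertex (derived D u₁ u₂ u₁≢u₂ r) zero = isDerived (s≤s z≤n) (s≤s z≤n) edge₁ edge₂ r
  vertex (derived D u₁ u₂ u₁≢u₂ r) (suc u) with vertex D u
  ... | isInput noEdge               = isInput λ { _ (deriv↑ e) → noEdge _ e }
  ... | isDerived v₁>u v₂>u e₁ e₂ r′ = isDerived (s≤s v₁>u) (s≤s v₂>u) (deriv↑ e₁) (deriv↑ e₂) r′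

  module _ {P : Pred (XorClause n) 0ℓ}
           (P-closed : ∀ {C₁ C₂ C} → P C₁ → P C₂ → C₁ , C₂ ⊢ C → P C) where

    derivation-invariant : (∀ {C} → C ∈ Φ ++ map ⟦_⟧ A → P C) →
      ∀ {k} {L : Vec (XorClause n) k} → UPDerivation Φ A L → ∀ u → P (lookup L u)
    derivation-invariant P-in (input D C∈)          zero    = P-in C∈
    derivation-invariant P-in (input D C∈)          (suc u) = derivation-invariant P-in D u
    derivation-invariant P-in (derived D u₁ u₂ _ r) zero    =
      P-closed (derivation-invariant P-in D u₁) (derivation-invariant P-in D u₂) r
    derivation-invariant P-in (derived D u₁ u₂ _ r) (suc u) = derivation-invariant P-in D u

    -- A walk backwards from `v` inside `V_b` meets no input vertex, since those lie in `Vₐ`, and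
    -- each edge entering from `Vₐ` starts at a clause of `Φ` or at a reason. Whatever lies behind
    -- the cut is irrelevant.
    cut-invariant : ∀ {k} {L : Vec (XorClause n) k} (D : UPDerivation Φ A L) {Vₐ v} →
      IsCut D Vₐ v → (∀ {C} → C ∈ Φ → P C) → (∀ {u} → Reasons D Vₐ u → P (lookup L u)) →
      P (lookup L v)
    cut-invariant {L = L} D {Vₐ} {v} cut P-Φ P-reasons = below (>-wellFounded v) ε v∈V_b
      where
      open IsCut cut
      open DecMembership (_≟ˣ_ {n}) using (_∈?_)

      below : ∀ {u} → Acc _>_ u → Star (Edge D) u v → u ∉ˢ Vₐ → P (lookup L u)
      parent : ∀ {u w} → Acc _>_ u → Edge D u w → Star (Edge D) w v → w ∉ˢ Vₐ → P (lookup L u)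

      below {u} (acc rec) path u∉Vₐ with vertex D u
      ... | isInput noEdge = contradiction (inputs u noEdge path) u∉Vₐ
      ... | isDerived u₁>u u₂>u e₁ e₂ r =
        P-closed (parent (rec u₁>u) e₁ path u∉Vₐ) (parent (rec u₂>u) e₂ path u∉Vₐ) r

      parent {u} {w} a e path w∉Vₐ with u ∈ˢ? Vₐ | lookup L u ∈? Φ
      ... | no u∉Vₐ  | _       = below a (e ◅ path) u∉Vₐ
      ... | yes u∈Vₐ | yes L∈Φ = P-Φ L∈Φ
      ... | yes u∈Vₐ | no L∉Φ  = P-reasons (u∈Vₐ , L∉Φ , w , w∉Vₐ , e)

-- Truth of xor-clauses and literals under an assignment.

-- The inner product over the two-element field. For a clause and the true atoms it is the parity of
-- the number of true literals, in a form that is linear in the clause.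
dot : ∀ {k} → Vec Bool k → Vec Bool k → Bool
dot []      []      = false
dot (a ∷ p) (b ∷ q) = (a ∧ᵇ b) xor dot p q

dot-⊕ : ∀ {k} (p q t : Vec Bool k) → dot (zipWith _xor_ p q) t ≡ dot p t xor dot q t
dot-⊕ []      []      []      = refl
dot-⊕ (a ∷ p) (b ∷ q) (c ∷ t) = begin
  ((a xor b) ∧ᵇ c) xor dot (zipWith _xor_ p q) t
    ≡⟨ cong₂ _xor_ (∧-distribʳ-xor c a b) (dot-⊕ p q t) ⟩
  ((a ∧ᵇ c) xor (b ∧ᵇ c)) xor (dot p t xor dot q t)
    ≡⟨ interchange (a ∧ᵇ c) (b ∧ᵇ c) (dot p t) (dot q t) ⟩
  ((a ∧ᵇ c) xor dot p t) xor ((b ∧ᵇ c) xor dot q t) ∎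
  where
  open ≡-Reasoning
  open CommutativeSemigroupProperties
    (CommutativeRing.+-commutativeSemigroup xor-∧-commutativeRing) using (interchange)

dot-∅ : ∀ {k} (t : Vec Bool k) → dot ∅ t ≡ false
dot-∅ []      = refl
dot-∅ (b ∷ t) = dot-∅ t

dot-⁅⁆ : ∀ {k} (a : Fin k) t → dot ⁅ a ⁆ t ≡ lookup t a
dot-⁅⁆ zero    (b ∷ t) = trans (cong (b xor_) (dot-∅ t)) (xor-identityʳ b)
dot-⁅⁆ (suc a) (b ∷ t) = dot-⁅⁆ a t

Holds : ∀ {n} → Assignment n → XorClause n → Set
Holds ν C = dot C (trueAtoms ν) ≡ true

holds-⟦⟧⁺ : ∀ {n} (ν : Assignment n) l → ν ⊨ˡ l → Holds ν ⟦ l ⟧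
holds-⟦⟧⁺ ν (true  , a) eq = trans (dot-⁅⁆ a (trueAtoms ν)) eq
holds-⟦⟧⁺ ν (false , a) eq =
  trans (dot-⊕ ⁅ a ⁆ ⊤ˣ (trueAtoms ν))
        (cong₂ _xor_ (trans (dot-⁅⁆ a (trueAtoms ν)) eq) (dot-⁅⁆ topₐ (trueAtoms ν)))

holds-⟦⟧⁻ : ∀ {n} (ν : Assignment n) l → Holds ν ⟦ l ⟧ → ν ⊨ˡ l
holds-⟦⟧⁻ ν (true  , a) h = trans (sym (dot-⁅⁆ a (trueAtoms ν))) h
holds-⟦⟧⁻ ν (false , a) h with lookup (trueAtoms ν) a in eq
... | false = refl
... | true with () ← trans (sym h) (trans (dot-⊕ ⁅ a ⁆ ⊤ˣ (trueAtoms ν))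
        (cong₂ _xor_ (trans (dot-⁅⁆ a (trueAtoms ν)) eq) (dot-⁅⁆ topₐ (trueAtoms ν))))

-- The sum of three truths is true; this is the soundness of both rules.
holds-resolvent : ∀ {n} (ν : Assignment n) C₁ C₂ → Holds ν C₁ → Holds ν C₂ → Holds ν (C₂ ⊕ C₁ ⊕ ⊤ˣ)
holds-resolvent ν C₁ C₂ h₁ h₂ =
  trans (dot-⊕ (C₂ ⊕ C₁) ⊤ˣ t)
        (cong₂ _xor_ (trans (dot-⊕ C₂ C₁ t) (cong₂ _xor_ h₂ h₁)) (dot-⁅⁆ topₐ t))
  where t = trueAtoms ν

⊨~ : ∀ {n} {ν : Assignment n} l → ¬ (ν ⊨ˡ ~ l) → ν ⊨ˡ l
⊨~ {ν = ν} (b , a) ν⊭ with lookup (trueAtoms ν) a | b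
... | true  | true  = refl
... | true  | false = contradiction refl ν⊭
... | false | true  = contradiction refl ν⊭
... | false | false = refl

⊭~ : ∀ {n} {ν : Assignment n} l → ν ⊨ˡ l → ¬ (ν ⊨ˡ ~ l)
⊭~ (b , a) eq eq′ = not-¬ refl (trans (sym eq) eq′)

-- Or-clauses and what an implicative explanation excludes.

infix 4 _⊨ᶜ_ _⊨ᶜ?_

_⊨ᶜ_ : ∀ {n} → Assignment n → OrClause n → Set
ν ⊨ᶜ C = Any (ν ⊨ˡ_) C

_⊨ᶜ?_ : ∀ {n} (ν : Assignment n) C → Dec (ν ⊨ᶜ C)
ν ⊨ᶜ? C = any? (λ (b , a) → lookup (trueAtoms ν) a ≟ᵇ b) C

falsified-literals : ∀ {n} {ν : Assignment n} {ls l} → ¬ (ν ⊨ᶜ implyingClause ls l) →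
                     ∀ {l′} → l′ ∈ ls → ν ⊨ˡ l′
falsified-literals {ν = ν} ν⊭C {l′} l′∈ls =
  ⊨~ {ν = ν} l′ (λ ν⊨~l′ → ν⊭C (there (Any.map (λ { refl → ν⊨~l′ }) (∈-map⁺ ~_ l′∈ls))))

-- Along the cut a label either still contains both y and z or holds under
-- both assignments, since a unary label cannot do the former, and one that
-- does the latter eliminates neither y nor z.
implicative-excludes-one : ∀ {n Φ A ls l s} {ν ν′ : Assignment n} {y z} →
  (∀ {C} → C ∈ Φ → ∀ x → var x ∈ˢ C) →
  y ≢ z → lookup ν y ≢ lookup ν′ y → lookup ν z ≢ lookup ν′ z →
  Implies Φ A implicativeOnly ls l s →
  ¬ (ν ⊨ᶜ implyingClause ls l) → ν′ ⊨ᶜ implyingClause ls l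
implicative-excludes-one Φ-full y≢z _ _ (given {l = b , a} l∈Φ) _ =
  -- A conjunct of `Φ` contains both `y` and `z`, so it is no literal.
  contradiction (Φ-full l∈Φ _) (⟦⟧-distinct b a y≢z (Φ-full l∈Φ _))
implicative-excludes-one {n} {Φ} {A} {ν = ν} {ν′} {y} {z} Φ-full y≢z νy≢ν′y νz≢ν′z
  (implicative {v = v} {l} {ls} {L} D Lv≡l cut cnf labels _) ν⊭C =
  -- Suppose that `ν′` falsifies the clause too. Then every reason holds under both assignments, and
  -- by the invariant `⟦ l ⟧` contains both `y` and `z` or holds under `ν`; neither is possible.
  decidable-stable (ν′ ⊨ᶜ? implyingClause ls l) λ ν′⊭C →
    [ (λ (y∈ , z∈) → not-unary l (subst (λ C → var y ∈ˢ C × var z ∈ˢ C) Lv≡l (y∈ , z∈)))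
    , (λ (h , _) → ν⊭C (here (holds-⟦⟧⁻ ν l (subst (Holds ν) Lv≡l h))))
    ]′ (cut-invariant P-closed D cut (λ C∈Φ → inj₁ (Φ-full C∈Φ y , Φ-full C∈Φ z))
                      (P-reasons ν′⊭C))
  where
  P : Pred (XorClause n) 0ℓ
  P C = (var y ∈ˢ C × var z ∈ˢ C) ⊎ (Holds ν C × Holds ν′ C)

  not-unary : ∀ l → ¬ (var y ∈ˢ ⟦ l ⟧ × var z ∈ˢ ⟦ l ⟧)
  not-unary (b , a) (y∈ , z∈) = ⟦⟧-distinct b a y≢z y∈ z∈

  agree : ∀ b x {w} → Holds ν ⟦ b , var x ⟧ → Holds ν′ ⟦ b , var x ⟧ →
          lookup ν w ≢ lookup ν′ w → w ≢ x
  agree b x h h′ νw≢ν′w refl =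
    νw≢ν′w (trans (holds-⟦⟧⁻ ν (b , var x) h) (sym (holds-⟦⟧⁻ ν′ (b , var x) h′)))

  P-closed : ∀ {C₁ C₂ C} → P C₁ → P C₂ → C₁ , C₂ ⊢ C → P C
  P-closed p₁ p₂ r with ⊢-⊕⁻ r
  P-closed (inj₁ both) p₂ r | resolves b x refl x∈ = contradiction both (not-unary (b , var x))
  P-closed (inj₂ (h , h′)) (inj₁ (y∈ , z∈)) r | resolves b x refl x∈ =
    inj₁ (∈-resolvent b (agree b x h h′ νy≢ν′y) y∈ , ∈-resolvent b (agree b x h h′ νz≢ν′z) z∈)
  P-closed {C₁} {C₂} (inj₂ (h , h′)) (inj₂ (g , g′)) r | resolves b x refl x∈ =
    inj₂ (holds-resolvent ν ⟦ b , var x ⟧ C₂ h g , holds-resolvent ν′ ⟦ b , var x ⟧ C₂ h′ g′)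

  P-reasons : ¬ (ν′ ⊨ᶜ implyingClause ls l) → ∀ {u} → Reasons D _ u → P (lookup L u)
  P-reasons ν′⊭C {u} reason with cnf u reason
  ... | b , x , Lu≡l′ = inj₂ (holds ν ν⊭C , holds ν′ ν′⊭C)
    where
    holds : ∀ μ → ¬ (μ ⊨ᶜ implyingClause ls l) → Holds μ (lookup L u)
    holds μ μ⊭C = subst (Holds μ) (sym Lu≡l′) (holds-⟦⟧⁺ μ (b , var x)
      (falsified-literals μ⊭C (Equivalence.from (labels (b , var x)) (u , reason , Lu≡l′))))

-- Soundness of trails and of resolution for a fixed assignment.

-- Decisions may contradict `ν`. Only the implying clauses are required to hold under `ν`, together
-- with the fact that each was unit when it was used.
data Forces {n} (ν : Assignment n) : Trail n → Set where
  []       : Forces ν []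
  decided : ∀ {π l} → Forces ν π → Forces ν (decision l ∷ π)
  forced  : ∀ {π l C} → ν ⊨ᶜ C → (∀ k → k ∈ C → k ≢ l → IsFalse π k) →
             Forces ν π → Forces ν (implied l C ∷ π)

forces-clause : ∀ {n} {ν : Assignment n} {π l C} → Forces ν π → implied l C ∈ π → ν ⊨ᶜ C
forces-clause (decided f)    (there i∈π)  = forces-clause f i∈π
forces-clause (forced s _ f) (here refl)  = s
forces-clause (forced _ _ f) (there i∈π)  = forces-clause f i∈π

forces-suffix : ∀ {n} {ν : Assignment n} π₂ {π₁} → Forces ν (π₂ ++ π₁) → Forces ν π₁
forces-suffix []       f               = f
forces-suffix (_ ∷ π₂) (decided f)    = forces-suffix π₂ f
forces-suffix (_ ∷ π₂) (forced _ _ f) = forces-suffix π₂ f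

-- Induction along a trail without decisions: `ν` satisfies the clause of the latest entry, but by
-- induction none of its other literals, so it makes the implied literal true.
forces-true : ∀ {n} {ν : Assignment n} {π} → Forces ν π → All IsImplied π →
              ∀ {l} → IsTrue π l → ν ⊨ˡ l
forces-true f                 imp       (inj₁ refl) = refl
forces-true (forced s rest f) (_ ∷ imp) (inj₂ (there l∈)) = forces-true f imp (inj₂ l∈)
forces-true {ν = ν} (forced {π} {l} {C} s rest f) (_ ∷ imp) (inj₂ (here refl)) = pick s rest
  where
  pick : ∀ {K} → ν ⊨ᶜ K → (∀ k → k ∈ K → k ≢ l → IsFalse π k) → ν ⊨ˡ l
  pick {k ∷ K} (here ν⊨k) rest with k ≟ˡ l
  ... | yes refl = ν⊨k
  ... | no k≢l   = contradiction (forces-true f imp (rest k (here refl) k≢l)) (⊭~ {ν = ν} k ν⊨k)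
  pick {k ∷ K} (there s) rest = pick s (λ k k∈ → rest k (there k∈))

falsified⇒⊭ : ∀ {n} {ν : Assignment n} {π K} →
              Forces ν π → All IsImplied π → Falsified π K → ¬ (ν ⊨ᶜ K)
falsified⇒⊭ {ν = ν} f imp (k-false ∷ _) (here {x = k} ν⊨k) =
  ⊭~ {ν = ν} k ν⊨k (forces-true f imp k-false)
falsified⇒⊭ f imp (_ ∷ K-false) (there s) = falsified⇒⊭ f imp K-false s

⊨-find : ∀ {n} {ν : Assignment n} {C} → ν ⊨ᶜ C → ∃ λ l → l ∈ C × ν ⊨ˡ l
⊨-find (here s)  = _ , here refl , s
⊨-find (there s) with ⊨-find s
... | l , l∈ , ν⊨l = l , there l∈ , ν⊨l

⊨-lose : ∀ {n} {ν : Assignment n} {C l} → l ∈ C → ν ⊨ˡ l → ν ⊨ᶜ C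
⊨-lose l∈C ν⊨l = Any.map (λ { refl → ν⊨l }) l∈C

-- The true literal of `K` survives unless it is `~ l`. In that case `l` is false, so the true
-- literal of `C` is another one and survives.
⊨-resolvent : ∀ {n} {ν : Assignment n} {l K C} → ν ⊨ᶜ K → ν ⊨ᶜ C → ν ⊨ᶜ resolvent l K C
⊨-resolvent {ν = ν} {l} {K} {C} ν⊨K ν⊨C with ⊨-find ν⊨K | ⊨-find ν⊨C
... | k , k∈K , ν⊨k | c , c∈C , ν⊨c with k ≟ˡ ~ l
... | no k≢~l  =
  ⊨-lose (∈-deduplicate⁺ _≟ˡ_ (∈-++⁺ˡ (∈-filter⁺ (λ k → ¬? (k ≟ˡ ~ l)) k∈K k≢~l))) ν⊨k
... | yes refl =
  ⊨-lose (∈-deduplicate⁺ _≟ˡ_ (∈-++⁺ʳ _ (∈-filter⁺ (λ k → ¬? (k ≟ˡ l)) c∈C c≢l))) ν⊨c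
  where
  c≢l : c ≢ l
  c≢l refl = ⊭~ {ν = ν} l ν⊨c ν⊨k

-- The invariant carried along a run by an assignment that no clause has excluded; the final state
-- admits none.
Consistent : ∀ {n} → Assignment n → State n → Set
Consistent ν (clausal π Λ)    = Forces ν π × All (ν ⊨ᶜ_) Λ
Consistent ν (xorModule π Λ)  = Forces ν π × All (ν ⊨ᶜ_) Λ
Consistent ν (conflict π Λ K) = Forces ν π × All (ν ⊨ᶜ_) Λ × ν ⊨ᶜ K
Consistent ν unsatisfiable    = ⊥

implies-premises : ∀ {n Φ ls l s} {A : List (Literal n)} →
                   Implies Φ A implicativeOnly ls l s → All (_∈ A) ls
implies-premises (given _)                   = []
implies-premises (implicative _ _ _ _ _ ls∈) = ls∈

-- Counting the assignments that survive a run.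

-- The first element that fails `P` forces all later ones to satisfy it, so nothing else is dropped.
filter-loses-one : ∀ {A : Set} {P : Pred A 0ℓ} (P? : Decidable P) {xs} → Unique xs →
  (∀ {x y} → x ≢ y → ¬ P x → P y) → length xs ≤ suc (length (filter P? xs))
filter-loses-one P? [] _ = z≤n
filter-loses-one P? {x ∷ xs} (x∉xs ∷ uniq) excl with P? x
... | yes px = s≤s (filter-loses-one P? uniq excl)
... | no ¬px rewrite filter-all P? (All.map (λ x≢y → excl x≢y ¬px) x∉xs) = ≤-refl

-- By `excl`, an implying clause excludes at most one test assignment. As `φ` has no or-clauses, all
-- clauses of a run are implying clauses or resolvents of these.
module LowerBound {n} {T : Set} (φ : CnfXor n) (no-or : orPart φ ≡ [])
  (test : T → Assignment n)
  (excl : ∀ {A ls l s} → Implies (xorPart φ) A implicativeOnly ls l s → ∀ {w w′} → w ≢ w′ →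
          ¬ (test w ⊨ᶜ implyingClause ls l) → test w′ ⊨ᶜ implyingClause ls l)
  where

  surviving : OrClause n → List T → List T
  surviving C = filter (λ w → test w ⊨ᶜ? C)

  clause-sat : ∀ {ν Λ C} → All (ν ⊨ᶜ_) Λ → C ∈ orPart φ ++ Λ → ν ⊨ᶜ C
  clause-sat {Λ = Λ} sat C∈ rewrite no-or = All.lookup sat C∈

  premises-false : ∀ {ls l} {π : Trail n} → All (_∈ lits π) ls →
                   ∀ k → k ∈ implyingClause ls l → k ≢ l → IsFalse π k
  premises-false ls∈ k (here refl) k≢l = contradiction refl k≢l
  premises-false {π = π} ls∈ k (there k∈) _ with ∈-map⁻ ~_ k∈
  -- Knowing the sign lets the double negation `~ ~` reduce.
  ... | (true  , a) , l′∈ , refl = inj₂ (All.lookup ls∈ l′∈)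
  ... | (false , a) , l′∈ , refl = inj₂ (All.lookup ls∈ l′∈)

  -- `W` lists test assignments that are still consistent. A step that returns an implying clause
  -- loses at most one of them and has size at least one; the other steps lose none, and
  -- `unsatisfiable` leaves none.
  run-length : ∀ {s c} → Run implicativeOnly φ s c unsatisfiable →
               ∀ {W} → Unique W → All (λ w → Consistent (test w) s) W → length W ≤ c

  keep : ∀ {s t c d} → Step implicativeOnly φ s c t → Run implicativeOnly φ t d unsatisfiable →
    ∀ {W} → Unique W → (∀ {w} → Consistent (test w) s → Consistent (test w) t) →
    All (λ w → Consistent (test w) s) W → length W ≤ c + d

  module-step : ∀ {s A ls l e c d} → Implies (xorPart φ) A implicativeOnly ls l e →
    Run implicativeOnly φ s d unsatisfiable → ∀ {W} → Unique W →
    (∀ {w} → w ∈ W → test w ⊨ᶜ implyingClause ls l → Consistent (test w) s) →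
    length W ≤ suc c + d

  run-length stop uniq []       = z≤n
  run-length stop uniq (() ∷ _)
  run-length (st@(propagate C∈ (_ , _ , rest)) ◅ run) uniq =
    keep st run uniq λ (f , sat) → forced (clause-sat sat C∈) rest f , sat
  run-length (st@(orConflict C∈ _) ◅ run) uniq =
    keep st run uniq λ (f , sat) → f , sat , clause-sat sat C∈
  run-length (st@(callModule _) ◅ run)  uniq = keep st run uniq id
  run-length (st@(moduleDone _) ◅ run)  uniq = keep st run uniq id
  run-length (st@(decide _ _ _) ◅ run)  uniq =
    keep st run uniq λ (f , sat) → decided f , sat
  run-length (st@(resolve i∈π _) ◅ run) uniq =
    keep st run uniq λ (f , sat , ν⊨K) → f , sat , ⊨-resolvent ν⊨K (forces-clause f i∈π)
  run-length (st@(backjump {π₂ = π₂} {d} refl _) ◅ run) uniq =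
    keep st run uniq λ (f , sat , ν⊨K) →
      forces-suffix (decision d ∷ []) (forces-suffix π₂ f) , ν⊨K ∷ sat
  -- The remaining trail has no decisions, so a consistent assignment makes it true and falsifies
  -- `K`, which it also satisfies.
  run-length (st@(returnUnsat {π₂ = π₂} refl imp K-false) ◅ run) uniq =
    keep st run uniq λ (f , _ , ν⊨K) → falsified⇒⊭ (forces-suffix π₂ f) imp K-false ν⊨K
  run-length (xorImplied imp _ ◅ run) uniq cons =
    module-step imp run uniq λ w∈ ν⊨C →
      let f , sat = All.lookup cons w∈ in
      forced ν⊨C (premises-false (implies-premises imp)) f , sat
  run-length (xorConflict imp _ ◅ run) uniq cons =
    module-step imp run uniq λ w∈ ν⊨C →
      let f , sat = All.lookup cons w∈ in f , sat , ν⊨C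

  keep {c = c} _ run uniq step cons = m≤n⇒m≤o+n c (run-length run uniq (All.map step cons))

  module-step {s} {ls = ls} {l} {c = c} {d} imp run {W} uniq step = begin
    length W                      ≤⟨ filter-loses-one P? uniq (excl imp) ⟩
    suc (length (surviving C W))
      ≤⟨ s≤s (run-length run (Unique.filter⁺ P? uniq) (All.tabulate cons)) ⟩
    suc d                         ≤⟨ s≤s (m≤n+m d c) ⟩
    suc c + d                     ∎
    where
    open ≤-Reasoning
    C = implyingClause ls l
    P? = λ w → test w ⊨ᶜ? C
    cons : ∀ {w} → w ∈ surviving C W → Consistent (test w) s
    cons w∈ = let w∈W , ν⊨C = ∈-filter⁻ P? w∈ in step w∈W ν⊨C

-- The formulas and their unsatisfiability.

-- x₁ ⊕ ⋯ ⊕ xₙ, with ⊕ ⊤ if b.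
full⊕ : ∀ {n} → Bool → XorClause n
full⊕ b = b ∷ full

parityPair : ∀ n → CnfXor n
parityPair n = [] ∧ (full⊕ false ∷ full⊕ true ∷ [])

parityPair-full : ∀ {n C} → C ∈ xorPart (parityPair n) → ∀ x → var x ∈ˢ C
parityPair-full (here refl)         x = Vec.there ∈⊤
parityPair-full (there (here refl)) x = Vec.there ∈⊤

-- Both clauses count the same true variables, and the second one also counts `⊤`. The two counts
-- are consecutive, so they are not both odd.
parityPair-unsat : ∀ n → Unsatisfiable (n , parityPair n)
parityPair-unsat n (ν , _ , odd ∷ odd′ ∷ []) = consecutive ∣ full ∩ ν ∣ odd odd′
  where
  consecutive : ∀ k → k % 2 ≡ 1 → ¬ (suc k % 2 ≡ 1)
  consecutive zero          ()
  consecutive (suc zero)    _ ()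
  consecutive (suc (suc k)) p q =
    consecutive k (trans (sym ([m+n]%n≡m%n k 2)) (trans (cong (_% 2) (+-comm k 2)) p))
                  (trans (sym ([m+n]%n≡m%n (suc k) 2)) (trans (cong (_% 2) (+-comm (suc k) 2)) q))

-- Short runs with parity explanations: the decisions.

module UpperBound (j : ℕ) where

  open DecMembership (_≟ˣ_ {2 + j}) using (_∈?_)

  Φ : List (XorClause (2 + j))
  Φ = xorPart (parityPair (2 + j))

  -- Every variable except `zero` is decided, and made true; `suc` skips `zero`.
  assumption : Fin (suc j) → Literal (2 + j)
  assumption x = pos (var (suc x))

  decisions : List (Fin (suc j)) → Trail (2 + j)
  decisions = map (decision ∘ assumption)

  ∈-lits⁺ : ∀ {x xs} → x ∈ xs → assumption x ∈ lits (decisions xs)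
  ∈-lits⁺ = ∈-map⁺ literal ∘ ∈-map⁺ (decision ∘ assumption)

  ∈-lits⁻ : ∀ {l xs} → l ∈ lits (decisions xs) → ∃ λ x → x ∈ xs × l ≡ assumption x
  ∈-lits⁻ l∈ with ∈-map⁻ literal l∈
  ... | _ , e∈ , refl with ∈-map⁻ (decision ∘ assumption) e∈
  ... | x , x∈ , refl = x , x∈ , refl

  ⟦⟧-injective⁺ : ∀ l {x} → ⟦ l ⟧ ≡ ⟦ assumption x ⟧ → l ≡ assumption x
  ⟦⟧-injective⁺ (b , a) {x} eq
    with ∈⟦⟧⁻ b a (subst (var (suc x) ∈ˢ_) (sym eq) (∈⟦⟧⁺ true (suc x)))
  ⟦⟧-injective⁺ (true  , _) eq | refl = refl
  ⟦⟧-injective⁺ (false , _) () | refl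

  ⟦⟧≡⊤ˣ : ∀ {l : Literal (2 + j)} → ⟦ l ⟧ ≡ ⊤ˣ → l ≡ pos topₐ
  ⟦⟧≡⊤ˣ {true  , topₐ} eq = refl
  ⟦⟧≡⊤ˣ {b , var x} eq = contradiction (subst (var x ∈ˢ_) eq (∈⟦⟧⁺ b x)) var∉⊤ˣ

  assumption∉Φ : ∀ {C x} → C ≡ ⟦ assumption x ⟧ → C ∉ Φ
  assumption∉Φ {x = x} refl C∈Φ with () ← ∈⟦⟧⁻ true (var (suc x)) (parityPair-full C∈Φ zero)

  -- A decision requires that the module has nothing new to return. While `suc x` is undecided, a
  -- derivable clause is an assumption, is `⊤`, or contains both `zero` and `suc x`; the last kind
  -- is never a literal.
  saturated : ∀ {x xs} → x ∉ xs → XorSaturated (decisions xs) Φ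
  saturated {x} {xs} x∉xs l (_ , L , D , v , Lv≡l) =
    conclude (derivation-invariant P-closed P-input D v) Lv≡l
    where
    data P : XorClause (2 + j) → Set where
      assumed : ∀ {y} → y ∈ xs → P ⟦ assumption y ⟧
      trivial : P ⊤ˣ
      wide    : ∀ {C} → var zero ∈ˢ C → var (suc x) ∈ˢ C → P C

    P-input : ∀ {C} → C ∈ Φ ++ map ⟦_⟧ (lits (decisions xs)) → P C
    P-input C∈ with ∈-++⁻ Φ C∈
    ... | inj₁ C∈Φ = wide (parityPair-full C∈Φ _) (parityPair-full C∈Φ _)
    ... | inj₂ C∈A with ∈-map⁻ ⟦_⟧ C∈A
    ... | l , l∈ , refl with ∈-lits⁻ l∈
    ... | y , y∈ , refl = assumed y∈

    P-closed : ∀ {C₁ C₂ C} → P C₁ → P C₂ → C₁ , C₂ ⊢ C → P C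
    P-closed p₁ p₂ r with ⊢-⊕⁻ r
    ... | resolves b z refl z∈C₂ = resolved p₁ refl p₂ z∈C₂
      where
      resolved : ∀ {C₁ C₂} → P C₁ → C₁ ≡ ⟦ b , var z ⟧ → P C₂ → var z ∈ˢ C₂ → P (C₂ ⊕ C₁ ⊕ ⊤ˣ)
      resolved (wide 0∈ x∈) refl _ _ = contradiction x∈ (⟦⟧-distinct b (var z) (λ ()) 0∈)
      resolved trivial eq _ _ =
        contradiction (subst (var z ∈ˢ_) (sym eq) (∈⟦⟧⁺ b z)) var∉⊤ˣ
      resolved (assumed {y} y∈) eq p z∈ with ⟦⟧-injective⁺ (b , var z) (sym eq)
      resolved (assumed {y} y∈) eq trivial z∈ | refl = contradiction z∈ var∉⊤ˣ
      resolved (assumed {y} y∈) eq (wide 0∈ x∈) z∈ | refl =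
        wide (∈-resolvent true {suc y} (λ ()) 0∈)
             (∈-resolvent true {suc y} (λ { refl → x∉xs y∈ }) x∈)
      -- Two vertices may carry the same assumption; resolving them gives `⊤`.
      resolved (assumed {y} y∈) eq (assumed {y′} y′∈) z∈ | refl
        with refl ← ∈⟦⟧⁻ true (var (suc y′)) z∈ =
        subst P (sym (trans (cong (_⊕ ⊤ˣ) (⊕-self ⟦ assumption y ⟧)) (⊕-identityˡ ⊤ˣ))) trivial

    conclude : ∀ {C} → P C → C ≡ ⟦ l ⟧ → IsTrue (decisions xs) l
    conclude (assumed y∈)  eq =
      inj₂ (subst (_∈ _) (sym (⟦⟧-injective⁺ l (sym eq))) (∈-lits⁺ y∈))
    conclude trivial       eq = inj₁ (⟦⟧≡⊤ˣ (sym eq))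
    conclude (wide 0∈ x∈) refl = contradiction x∈ (⟦⟧-distinct (proj₁ l) (proj₂ l) (λ ()) 0∈)

  unassigned : ∀ {x xs} → x ∉ xs → Unassigned (decisions xs) (assumption x)
  unassigned {x} x∉xs = not-true , not-false
    where
    not-true : ¬ IsTrue (decisions _) (assumption x)
    not-true (inj₂ l∈) with y , y∈ , refl ← ∈-lits⁻ l∈ = x∉xs y∈
    not-false : ¬ IsFalse (decisions _) (assumption x)
    not-false (inj₂ l∈) with ∈-lits⁻ l∈
    ... | _ , _ , ()

  or-saturated : {π : Trail (2 + j)} → OrSaturated π []
  or-saturated _ ()

  -- Each variable costs two steps of size one, a call of the module and a decision. The latest
  -- decision comes first, so the head of the list is decided last.
  prepend-decisions : ∀ {c} xs → Unique xs →
    Run parityAllowed (parityPair (2 + j)) (clausal (decisions xs) []) c unsatisfiable →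
    Run parityAllowed (parityPair (2 + j)) (clausal [] []) (length xs * 2 + c) unsatisfiable
  prepend-decisions [] _ run = run
  prepend-decisions {c} (x ∷ xs) (x≢ ∷ uniq) run =
    subst (λ c → Run parityAllowed (parityPair (2 + j)) (clausal [] []) c unsatisfiable)
      (arith (length xs * 2) c)
      (prepend-decisions xs uniq
        (callModule or-saturated
          ◅ decide (saturated x∉xs) or-saturated (unassigned x∉xs)
          ◅ run))
    where
    x∉xs = All.All¬⇒¬Any x≢
    arith : ∀ a c → a + (2 + c) ≡ 2 + (a + c)
    arith a c = trans (sym (+-assoc a 2 c)) (cong (_+ c) (+-comm a 2))

  -- The derivation that reduces both clauses in parallel.

  -- full⊕ b with the variables of xs replaced by ⊤
  reduct : Bool → List (Fin (suc j)) → XorClause (2 + j)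
  reduct b []       = full⊕ b
  reduct b (x ∷ xs) = reduct b xs ⊕ ⟦ assumption x ⟧ ⊕ ⊤ˣ

  -- Split off so that `labels (x ∷ xs)` unfolds to two new reducts and the assumption on `x`,
  -- followed by `labels xs`. The current reducts are always the vertices `zero` and `suc zero`.
  earlierLabels : ∀ xs → Vec (XorClause (2 + j)) (length xs * 3)
  earlierLabels []       = []
  earlierLabels (x ∷ xs) = ⟦ assumption x ⟧ ∷ reduct true xs ∷ reduct false xs ∷ earlierLabels xs

  labels : ∀ xs → Vec (XorClause (2 + j)) (2 + length xs * 3)
  labels xs = reduct true xs ∷ reduct false xs ∷ earlierLabels xs

  zero∈reduct : ∀ b xs → var zero ∈ˢ reduct b xs
  zero∈reduct b []       = Vec.there Vec.here
  zero∈reduct b (x ∷ xs) = ∈-resolvent true {suc x} (λ ()) (zero∈reduct b xs)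

  ∈reduct : ∀ b {x} xs → x ∉ xs → var (suc x) ∈ˢ reduct b xs
  ∈reduct b []       _    = Vec.there ∈⊤
  ∈reduct b (y ∷ xs) x∉ =
    ∈-resolvent true {suc y} (x∉ ∘ here ∘ suc-injective) (∈reduct b xs (x∉ ∘ there))

  lookup-reduct : ∀ b y xs x → lookup (reduct b (y ∷ xs)) (var x) ≡
                  lookup (reduct b xs) (var x) xor lookup ⟦ assumption y ⟧ (var x)
  lookup-reduct b y xs x = begin
    lookup (reduct b xs ⊕ ⟦ assumption y ⟧ ⊕ ⊤ˣ) (var x)
      ≡⟨ lookup-⊕ (reduct b xs ⊕ ⟦ assumption y ⟧) ⊤ˣ (var x) ⟩
    lookup (reduct b xs ⊕ ⟦ assumption y ⟧) (var x) xor lookup ⊤ˣ (var x)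
      ≡⟨ cong₂ _xor_ (lookup-⊕ (reduct b xs) ⟦ assumption y ⟧ (var x)) (lookup-replicate x false) ⟩
    (lookup (reduct b xs) (var x) xor lookup ⟦ assumption y ⟧ (var x)) xor false
      ≡⟨ xor-identityʳ _ ⟩
    lookup (reduct b xs) (var x) xor lookup ⟦ assumption y ⟧ (var x) ∎
    where open ≡-Reasoning

  ∉reduct : ∀ b {x xs} → Unique xs → x ∈ xs → lookup (reduct b xs) (var (suc x)) ≡ false
  ∉reduct b {x} {y ∷ xs} (y≢ ∷ _) (here refl) = trans (lookup-reduct b y xs (suc x))
    (cong₂ _xor_ ([]=⇒lookup (∈reduct b xs (All.All¬⇒¬Any y≢))) ([]=⇒lookup (∈⟦⟧⁺ true (suc x))))
  ∉reduct b {x} {y ∷ xs} (y≢ ∷ uniq) (there x∈) = trans (lookup-reduct b y xs (suc x))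
    (cong₂ _xor_ (∉reduct b uniq x∈)
      (∉⇒lookup λ x∈y → All.lookup y≢ x∈
        (sym (suc-injective (suc-injective (∈⟦⟧⁻ true (var (suc y)) x∈y))))))

  -- The two clauses differ by `⊤`, and each elimination adds the same summands to both, which
  -- cancel in the sum.
  reduct-⊕ : ∀ xs → reduct true xs ⊕ reduct false xs ≡ ⊤ˣ
  reduct-⊕ []       = cong (true ∷_) (∷-injectiveʳ (⊕-self (full⊕ true)))
  reduct-⊕ (x ∷ xs) =
    trans (⊕-cancelʳ (reduct true xs ⊕ p) (reduct false xs ⊕ p) ⊤ˣ)
          (trans (⊕-cancelʳ (reduct true xs) (reduct false xs) p) (reduct-⊕ xs))
    where p = ⟦ assumption x ⟧

  -- The set `Vₐ` of the cut, which consists of exactly the input vertices of `chain`.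
  inputs : (xs : List (Fin (suc j))) → Subset (2 + length xs * 3)
  inputs []       = inside ∷ inside ∷ []
  inputs (x ∷ xs) = outside ∷ outside ∷ inside ∷ inputs xs

  input-label : ∀ xs {u} → u ∈ˢ inputs xs →
    lookup (labels xs) u ∈ Φ ⊎ ∃ λ x → x ∈ xs × lookup (labels xs) u ≡ ⟦ assumption x ⟧
  input-label []       {zero}           _ = inj₁ (there (here refl))
  input-label []       {suc zero}       _ = inj₁ (here refl)
  input-label (x ∷ xs) {suc zero}       (Vec.there ())
  input-label (x ∷ xs) {suc (suc zero)} _ = inj₂ (x , here refl , refl)
  input-label (x ∷ xs) {suc (suc (suc u))} (Vec.there (Vec.there (Vec.there u∈)))
    with input-label xs u∈
  ... | inj₁ L∈Φ          = inj₁ L∈Φ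
  ... | inj₂ (y , y∈ , eq) = inj₂ (y , there y∈ , eq)

  module _ {A : List (Literal (2 + j))} where

    chain : ∀ xs → Unique xs → (∀ {x} → x ∈ xs → assumption x ∈ A) → UPDerivation Φ A (labels xs)
    chain [] _ _ = input (input empty (here refl)) (there (here refl))
    chain (x ∷ xs) (x≢ ∷ uniq) xs⊆A =
      -- The assumption on `x` is entered once and serves both reducts, which makes it cancel later.
      -- It has index `zero` in the inner step and `suc zero` in the outer one.
      derived (derived (input (chain xs uniq (xs⊆A ∘ there))
                              (∈-++⁺ʳ Φ (∈-map⁺ ⟦_⟧ (xs⊆A (here refl)))))
                       zero (suc (suc zero)) (λ ()) (⊢-⊕⁺ true (∈reduct false xs x∉xs)))
              (suc zero) (suc (suc zero)) (λ ()) (⊢-⊕⁺ true (∈reduct true xs x∉xs))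
      where x∉xs = All.All¬⇒¬Any x≢

    input-or-derived : ∀ xs uniq (xs⊆A : ∀ {x} → x ∈ xs → assumption x ∈ A) u →
      let D = chain xs uniq xs⊆A in
      (u ∈ˢ inputs xs × IsInput D u) ⊎ (u ∉ˢ inputs xs × ∃ λ w → Edge D w u)
    input-or-derived [] _ _ zero       = inj₁ (Vec.here , λ _ ())
    input-or-derived [] _ _ (suc zero) = inj₁ (Vec.there Vec.here , λ { _ (input↑ ()) })
    input-or-derived (x ∷ xs) (_ ∷ uniq) xs⊆A zero = inj₂ ((λ ()) , _ , edge₁)
    input-or-derived (x ∷ xs) (_ ∷ uniq) xs⊆A (suc zero) =
      inj₂ ((λ { (Vec.there ()) }) , _ , deriv↑ edge₁)
    input-or-derived (x ∷ xs) (_ ∷ uniq) xs⊆A (suc (suc zero)) =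
      inj₁ (Vec.there (Vec.there Vec.here) , λ { _ (deriv↑ (deriv↑ ())) })
    input-or-derived (x ∷ xs) (_ ∷ uniq) xs⊆A (suc (suc (suc u)))
      with input-or-derived xs uniq (xs⊆A ∘ there) u
    ... | inj₁ (u∈ , noEdge) =
      inj₁ (Vec.there (Vec.there (Vec.there u∈)) , λ { _ (deriv↑ (deriv↑ (input↑ e))) → noEdge _ e })
    ... | inj₂ (u∉ , w , e) =
      inj₂ (u∉ ∘ drop-there ∘ drop-there ∘ drop-there , _ , deriv↑ (deriv↑ (input↑ e)))

    assumption-vertex : ∀ xs uniq (xs⊆A : ∀ {x} → x ∈ xs → assumption x ∈ A) {x} → x ∈ xs →
      ∃₂ λ u w → u ∈ˢ inputs xs × w ∉ˢ inputs xs × Edge (chain xs uniq xs⊆A) u w ×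
                 lookup (labels xs) u ≡ ⟦ assumption x ⟧
    assumption-vertex (x ∷ xs) (_ ∷ uniq) xs⊆A (here refl) =
      suc (suc zero) , suc zero , Vec.there (Vec.there Vec.here) ,
      (λ { (Vec.there ()) }) , deriv↑ edge₁ , refl
    assumption-vertex (x ∷ xs) (_ ∷ uniq) xs⊆A (there x∈)
      with assumption-vertex xs uniq (xs⊆A ∘ there) x∈
    ... | u , w , u∈ , w∉ , e , eq =
      _ , _ , Vec.there (Vec.there (Vec.there u∈)) ,
      w∉ ∘ drop-there ∘ drop-there ∘ drop-there , deriv↑ (deriv↑ (input↑ e)) , eq

    -- At the start both values are `⊤`, as both labels are in `Φ`. Each elimination adds to both
    -- the value of one shared assumption vertex, and `⊤`.
    parityExpl-tracks : ∀ xs uniq (xs⊆A : ∀ {x} → x ∈ xs → assumption x ∈ A) →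
      let D = chain xs uniq xs⊆A in
      parityExpl D (inputs xs) zero ≡ parityExpl D (inputs xs) (suc zero)
    parityExpl-tracks [] _ _ = trans (axiom-expl (there (here refl))) (sym (axiom-expl (here refl)))
      where
      axiom-expl : ∀ {C} → C ∈ Φ → (if does (C ∈? Φ) then ⊤ˣ else C) ≡ ⊤ˣ
      axiom-expl {C} C∈Φ = cong (λ b → if b then ⊤ˣ else C) (dec-true (C ∈? Φ) C∈Φ)
    parityExpl-tracks (x ∷ xs) uniq′@(_ ∷ uniq) xs⊆A =
      cong (λ C → parityExpl (chain (x ∷ xs) uniq′ xs⊆A) (inputs (x ∷ xs)) (suc (suc zero))
                  ⊕ C ⊕ ⊤ˣ)
           (parityExpl-tracks xs uniq (xs⊆A ∘ there))

  -- The conflict and its parity explanation.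

  module Refutation {xs : List (Fin (suc j))} (uniq : Unique xs) (all∈ : ∀ x → x ∈ xs) where

    -- All variables but `zero` have been eliminated, so only the presence of `⊤` is open, and this
    -- is the sign.
    reduct-unary : ∃ λ b → reduct false xs ≡ ⟦ b , var zero ⟧
    reduct-unary with reduct false xs
                    | zero∈reduct false xs
                    | (λ x → ∉reduct false uniq (all∈ x))
    ... | c ∷ true ∷ C | Vec.there Vec.here | C-empty = helper c
      where
      C≡∅ : ∀ {k} (C : Vec Bool k) → (∀ x → lookup C x ≡ false) → C ≡ ∅
      C≡∅ []      _  = refl
      C≡∅ (b ∷ C) eq = cong₂ _∷_ (eq zero) (C≡∅ C (eq ∘ suc))

      helper : ∀ c → ∃ λ b → c ∷ true ∷ C ≡ ⟦ b , var zero ⟧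
      helper false = true , cong (λ C → false ∷ true ∷ C) (C≡∅ C C-empty)
      helper true  = false , cong (λ C → true ∷ true ∷ C)
        (trans (C≡∅ C C-empty) (sym (zipWith-identityʳ xor-identityʳ ∅)))

    A : List (Literal (2 + j))
    A = lits (decisions xs)

    base : UPDerivation Φ A (labels xs)
    base = chain xs uniq ∈-lits⁺

    refutationLabels : Vec (XorClause (2 + j)) (3 + length xs * 3)
    refutationLabels = (reduct true xs ⊕ reduct false xs ⊕ ⊤ˣ) ∷ labels xs

    -- Being unary, one reduct can act as the premise that eliminates `zero` from the other.
    reducts-clash : reduct false xs , reduct true xs ⊢
                    (reduct true xs ⊕ reduct false xs ⊕ ⊤ˣ)
    reducts-clash with b , eq ← reduct-unary =
      subst (λ C → C , reduct true xs ⊢ (reduct true xs ⊕ C ⊕ ⊤ˣ)) (sym eq)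
            (⊢-⊕⁺ b (zero∈reduct true xs))

    refutation : UPDerivation Φ A refutationLabels
    refutation = derived base (suc zero) zero (λ ()) reducts-clash

    cut : Subset (3 + length xs * 3)
    cut = outside ∷ inputs xs

    ∈cut⇒isInput : ∀ {u} → u ∈ˢ cut → IsInput refutation u
    ∈cut⇒isInput {suc u} (Vec.there u∈) with input-or-derived xs uniq ∈-lits⁺ u
    ... | inj₁ (_ , noEdge) = λ { _ (deriv↑ e) → noEdge _ e }
    ... | inj₂ (u∉ , _)     = contradiction u∈ u∉

    isInput⇒∈cut : ∀ {u} → IsInput refutation u → u ∈ˢ cut
    isInput⇒∈cut {zero}  noEdge = contradiction edge₁ (noEdge _)
    isInput⇒∈cut {suc u} noEdge with input-or-derived xs uniq ∈-lits⁺ u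
    ... | inj₁ (u∈ , _)    = Vec.there u∈
    ... | inj₂ (_ , _ , e) = contradiction (deriv↑ e) (noEdge _)

    cut-isCut : IsCut refutation cut zero
    cut-isCut = record
      { nonInput = _ , edge₁
      ; v∈V_b    = λ ()
      ; inputs   = λ _ noEdge _ → isInput⇒∈cut noEdge
      }

    reason-label : ∀ {u} → Reasons refutation cut u →
                   ∃ λ x → x ∈ xs × lookup refutationLabels u ≡ ⟦ assumption x ⟧
    reason-label {suc u} (Vec.there u∈ , L∉Φ , _) with input-label xs u∈
    ... | inj₁ L∈Φ = contradiction L∈Φ L∉Φ
    ... | inj₂ r   = r

    -- The two reducts have the same value of `f_W`, so all assumptions cancel and no variable is
    -- left to admit a premise.
    parityExpl-refutation : parityExpl refutation cut zero ≡ ⊤ˣ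
    parityExpl-refutation = begin
      f (suc zero) ⊕ f zero ⊕ ⊤ˣ
        ≡⟨ cong (λ C → f (suc zero) ⊕ C ⊕ ⊤ˣ) (parityExpl-tracks xs uniq ∈-lits⁺) ⟩
      f (suc zero) ⊕ f (suc zero) ⊕ ⊤ˣ
        ≡⟨ cong (_⊕ ⊤ˣ) (⊕-self (f (suc zero))) ⟩
      ⊥ˣ ⊕ ⊤ˣ
        ≡⟨ ⊕-identityˡ ⊤ˣ ⟩
      ⊤ˣ ∎
      where
      open ≡-Reasoning
      f = parityExpl base (inputs xs)

    refutation-implies : Implies Φ A parityAllowed [] (neg topₐ) (derivationSize refutationLabels)
    refutation-implies = parity refutation
      -- `⟦ neg topₐ ⟧` unfolds to `⊤ˣ ⊕ ⊤ˣ`.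
      (cong (_⊕ ⊤ˣ) (reduct-⊕ xs))
      cut-isCut
      (λ u r → let x , _ , eq = reason-label r in true , suc x , eq)
      (λ l → mk⇔ (to l) (from l))
      (All.tabulate id)
      (λ u u∈ _ → ∈cut⇒isInput u∈)
      -- Each reason has a variable and the explanation has none, so no premise remains.
      (λ l → mk⇔ (λ ()) (λ { (u , (r , sub) , _) → ⊥-elim (not-trivial r sub) }))
      where
      to : ∀ l → l ∈ A → ∃ λ u → Reasons refutation cut u × lookup refutationLabels u ≡ ⟦ l ⟧
      to l l∈ with ∈-lits⁻ l∈
      ... | x , x∈ , refl with assumption-vertex xs uniq ∈-lits⁺ x∈
      ... | u , w , u∈ , w∉ , e , eq =
        suc u , (Vec.there u∈ , assumption∉Φ eq , suc w , w∉ ∘ drop-there , deriv↑ e) , eq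

      from : ∀ l → (∃ λ u → Reasons refutation cut u × lookup refutationLabels u ≡ ⟦ l ⟧) → l ∈ A
      from l (u , r , eq) with reason-label r
      ... | x , x∈ , eq′ = subst (_∈ A) (sym (⟦⟧-injective⁺ l (trans (sym eq) eq′))) (∈-lits⁺ x∈)

      not-trivial : ∀ {u} → Reasons refutation cut u →
                    ¬ (lookup refutationLabels u vars⊆ parityExpl refutation cut zero)
      not-trivial r sub with reason-label r
      ... | x , _ , eq = contradiction (subst₂ _vars⊆_ eq parityExpl-refutation sub (x∈⁅x⁆ (suc x))) ∉⊥

    size : ℕ
    -- After the decisions: a call of the module, the conflict with a clause of length one, and the
    -- return.
    size = length xs * 2 + (1 + (2 + derivationSize refutationLabels + 1))

    unsat-run : Run parityAllowed (parityPair (2 + j)) (clausal [] []) size unsatisfiable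
    unsat-run = prepend-decisions xs uniq
      (callModule or-saturated
        ◅ xorConflict refutation-implies (inj₁ refl)
        ◅ returnUnsat (sym (++-identityʳ _)) [] (inj₁ refl ∷ [])
        ◅ stop)

-- Test assignments and the lower bound for implicative explanations.

duplicate : ∀ {m} → Vec Bool m → Assignment (m * 2)
duplicate []      = []
duplicate (b ∷ w) = b ∷ b ∷ duplicate w

-- A bit in which `w` and `w′` differ is copied to two adjacent variables.
duplicate-differs : ∀ {m} {w w′ : Vec Bool m} → w ≢ w′ → ∃₂ λ y z → y ≢ z ×
  lookup (duplicate w) y ≢ lookup (duplicate w′) y ×
  lookup (duplicate w) z ≢ lookup (duplicate w′) z
duplicate-differs {w = []}    {[]}      w≢w′ = contradiction refl w≢w′
duplicate-differs {w = b ∷ w} {b′ ∷ w′} w≢w′ with b ≟ᵇ b′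
... | no b≢b′ = zero , suc zero , (λ ()) , b≢b′ , b≢b′
... | yes refl with duplicate-differs (w≢w′ ∘ cong (b ∷_))
... | y , z , y≢z , dy , dz =
  suc (suc y) , suc (suc z) , y≢z ∘ suc-injective ∘ suc-injective , dy , dz

bitVectors : ∀ m → List (Vec Bool m)
bitVectors zero    = [] ∷ []
bitVectors (suc m) = map (true ∷_) (bitVectors m) ++ map (false ∷_) (bitVectors m)

bitVectors-unique : ∀ m → Unique (bitVectors m)
bitVectors-unique zero    = [] ∷ []
bitVectors-unique (suc m) =
  Unique.++⁺ (Unique.map⁺ ∷-injectiveʳ (bitVectors-unique m))
             (Unique.map⁺ ∷-injectiveʳ (bitVectors-unique m)) disjoint
  where
  disjoint : ∀ {w} → ¬ (w ∈ map (true ∷_) (bitVectors m) × w ∈ map (false ∷_) (bitVectors m))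
  disjoint (w∈₁ , w∈₂) with ∈-map⁻ (true ∷_) w∈₁ | ∈-map⁻ (false ∷_) w∈₂
  ... | _ , _ , refl | _ , _ , ()

length-bitVectors : ∀ m → length (bitVectors m) ≡ 2 ^ m
length-bitVectors zero    = refl
length-bitVectors (suc m) = begin
  length (map (true ∷_) (bitVectors m) ++ map (false ∷_) (bitVectors m))
    ≡⟨ length-++ (map (true ∷_) (bitVectors m)) ⟩
  length (map (true ∷_) (bitVectors m)) + length (map (false ∷_) (bitVectors m))
    ≡⟨ cong₂ _+_ (length-map (true ∷_) (bitVectors m)) (length-map (false ∷_) (bitVectors m)) ⟩
  length (bitVectors m) + length (bitVectors m)
    ≡⟨ cong₂ _+_ (length-bitVectors m) (trans (length-bitVectors m) (sym (+-identityʳ (2 ^ m)))) ⟩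
  2 ^ suc m ∎
  where open ≡-Reasoning

implicative-lower-bound : ∀ m {b} →
  HasProofOfSize≤ implicativeOnly (m * 2 , parityPair (m * 2)) b → 2 ^ m ≤ b
implicative-lower-bound m {b} (c , run , c≤b) = begin
  2 ^ m                  ≡⟨ length-bitVectors m ⟨
  -- With an empty trail and nothing learned, every test assignment is consistent.
  length (bitVectors m)  ≤⟨ run-length run (bitVectors-unique m) (All.tabulate λ _ → [] , []) ⟩
  c                      ≤⟨ c≤b ⟩
  b                      ∎
  where
  open ≤-Reasoning
  excludes-one : ∀ {A ls l s} → Implies (xorPart (parityPair (m * 2))) A implicativeOnly ls l s →
    ∀ {w w′} → w ≢ w′ →
    ¬ (duplicate w ⊨ᶜ implyingClause ls l) → duplicate w′ ⊨ᶜ implyingClause ls l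
  excludes-one imp w≢w′ with duplicate-differs {m} w≢w′
  ... | _ , _ , y≢z , dy , dz = implicative-excludes-one parityPair-full y≢z dy dz imp

  open LowerBound (parityPair (m * 2)) refl duplicate excludes-one

-- Exponential against polynomial growth.

open +-*-Solver using (solve; _:=_; _:+_; _:*_; con)

n<2^n : ∀ n → suc n ≤ 2 ^ n
n<2^n zero    = s≤s z≤n
n<2^n (suc n) = begin
  suc (suc n)       ≤⟨ +-mono-≤ (m^n>0 2 n) (n<2^n n) ⟩
  2 ^ n + 2 ^ n     ≡⟨ cong (2 ^ n +_) (+-identityʳ (2 ^ n)) ⟨
  2 ^ suc n         ∎
  where open ≤-Reasoning

-- As `x` is at least one, each power of `x` can be raised to the common exponent `length p`.
eval≤sum*^ : ∀ p x .{{_ : NonZero x}} → eval p x ≤ sum p * x ^ length p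
eval≤sum*^ []      x = z≤n
eval≤sum*^ (a ∷ p) x = begin
  a + x * eval p x
    ≤⟨ +-mono-≤ (m≤m*n a (x ^ suc d) {{m^n≢0 x (suc d)}}) (*-monoʳ-≤ x (eval≤sum*^ p x)) ⟩
  a * x ^ suc d + x * (sum p * x ^ d)
    ≡⟨ cong (a * x ^ suc d +_) (x∙yz≈y∙xz x (sum p) (x ^ d)) ⟩
  a * x ^ suc d + sum p * x ^ suc d
    ≡⟨ *-distribʳ-+ (x ^ suc d) a (sum p) ⟨
  (a + sum p) * x ^ suc d ∎
  where
  open ≤-Reasoning
  open CommutativeSemigroupProperties *-commutativeSemigroup using (x∙yz≈y∙xz)
  d = length p

formulaLength-parityPair : ∀ n → formulaLength (n , parityPair n) ≡ 3 + n * 2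
formulaLength-parityPair n rewrite ∣⊤∣≡n n =
  solve 1 (λ n → con 1 :+ n :+ (con 2 :+ n :+ con 0) := con 3 :+ n :* con 2) refl n

-- With i = 4^r and r = sum p + 4 deg p, the value of p at 7 + 4 i is at most
-- 2 ^ (sum p + (4 + 2 r) deg p), and the exponent is at most (1 + r)² ≤ i.
exponential-beats-polynomial : ∀ p → ∃ λ i → eval p (3 + suc i * 2 * 2) < 2 ^ suc i
exponential-beats-polynomial p = i , (begin-strict
  eval p x                     ≤⟨ eval≤sum*^ p x ⟩
  S * x ^ d                    ≤⟨ *-mono-≤ (≤-trans (n≤1+n S) (n<2^n S)) (^-monoˡ-≤ d x≤) ⟩
  2 ^ S * (2 ^ (4 + r * 2)) ^ d ≡⟨ cong (2 ^ S *_) (^-*-assoc 2 (4 + r * 2) d) ⟩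
  2 ^ S * 2 ^ ((4 + r * 2) * d) ≡⟨ ^-distribˡ-+-* 2 S ((4 + r * 2) * d) ⟨
  2 ^ (S + (4 + r * 2) * d)    ≤⟨ ^-monoʳ-≤ 2 exponent≤ ⟩
  2 ^ i                        <⟨ ^-monoʳ-< 2 (s≤s (s≤s z≤n)) (n<1+n i) ⟩
  2 ^ suc i                    ∎)
  where
  open ≤-Reasoning
  S = sum p
  d = length p
  r = S + d * 4
  i = 2 ^ (r * 2)
  -- The length of the formula with `suc i * 2` variables.
  x = 3 + suc i * 2 * 2

  x≤ : x ≤ 2 ^ (4 + r * 2)
  x≤ = begin
    3 + suc i * 2 * 2
      ≡⟨ solve 1 (λ i → con 3 :+ (con 1 :+ i) :* con 2 :* con 2 :=
                        con 7 :* con 1 :+ con 4 :* i) refl i ⟩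
    7 * 1 + 4 * i
      -- Here 7 is enlarged to `12 * i`, as `i` is at least one, in order to reach `16 * i`, a power
      -- of two.
      ≤⟨ +-monoˡ-≤ (4 * i) (*-mono-≤ (m≤m+n 7 5) (m^n>0 2 (r * 2))) ⟩
    12 * i + 4 * i
      ≡⟨ *-distribʳ-+ i 12 4 ⟨
    16 * i
      ≡⟨ ^-distribˡ-+-* 2 4 (r * 2) ⟨
    2 ^ (4 + r * 2) ∎

  d*2≤1+r : d * 2 ≤ suc r
  d*2≤1+r = begin
    d * 2      ≤⟨ *-monoʳ-≤ d (m≤m+n 2 2) ⟩
    d * 4      ≤⟨ m≤n+m (d * 4) (suc S) ⟩
    suc r      ∎

  exponent≤ : S + (4 + r * 2) * d ≤ i
  exponent≤ = begin
    S + (4 + r * 2) * d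
      ≡⟨ solve 3 (λ S d r → S :+ (con 4 :+ r :* con 2) :* d :=
                            (S :+ d :* con 4) :+ r :* (d :* con 2)) refl S d r ⟩
    r + r * (d * 2)
      ≤⟨ +-mono-≤ (n≤1+n r) (*-monoʳ-≤ r d*2≤1+r) ⟩
    suc r * suc r
      ≤⟨ *-mono-≤ (n<2^n r) (n<2^n r) ⟩
    2 ^ r * 2 ^ r
      ≡⟨ cong (2 ^ r *_) (*-identityʳ (2 ^ r)) ⟨
    (2 ^ r) ^ 2
      ≡⟨ ^-*-assoc 2 r 2 ⟩
    i ∎

-- The size of the parity proofs.

derivationSize≤ : ∀ {n k} (L : Vec (XorClause n) k) → derivationSize L ≤ k * (2 + n)
derivationSize≤ []      = z≤n
derivationSize≤ (C ∷ L) = +-mono-≤ (s≤s (∣p∣≤n C)) (derivationSize≤ L)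

-- That is, 2 x + 3 x²: the linear term covers the decisions and the closing steps, the quadratic
-- one a derivation with 3 (2 + j) labels of length at most 4 + j.
proofBound : Polynomial
proofBound = 0 ∷ 2 ∷ 3 ∷ []

parity-upper-bound : ∀ j → HasProofOfSize≤ parityAllowed (2 + j , parityPair (2 + j))
                             (eval proofBound (formulaLength (2 + j , parityPair (2 + j))))
parity-upper-bound j = size , unsat-run , (begin
  length xs * 2 + (1 + (2 + s + 1))
    ≡⟨ cong (λ k → k * 2 + (1 + (2 + s + 1))) len ⟩
  suc j * 2 + (1 + (2 + s + 1))
    ≡⟨ solve 2 (λ j s → (con 1 :+ j) :* con 2 :+ (con 1 :+ (con 2 :+ s :+ con 1)) :=
                        (con 3 :+ j) :* con 2 :+ s) refl j s ⟩
  (3 + j) * 2 + s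
    ≤⟨ +-monoʳ-≤ ((3 + j) * 2) (derivationSize≤ refutationLabels) ⟩
  (3 + j) * 2 + (3 + length xs * 3) * (4 + j)
    ≡⟨ cong (λ k → (3 + j) * 2 + (3 + k * 3) * (4 + j)) len ⟩
  (3 + j) * 2 + (2 + j) * 3 * (4 + j)
    ≤⟨ +-mono-≤ (*-monoˡ-≤ 2 (≤x 3 4 refl)) (*-mono-≤ (*-monoˡ-≤ 3 (≤x 2 5 refl)) (≤x 4 3 refl)) ⟩
  x * 2 + x * 3 * x
    ≡⟨ solve 1 (λ x → x :* con 2 :+ x :* con 3 :* x :=
                      x :* (con 2 :+ x :* (con 3 :+ x :* con 0))) refl x ⟩
  eval proofBound x ∎)
  where
  open ≤-Reasoning
  xs = allFin (suc j)
  open UpperBound j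
  open Refutation (Unique.allFin⁺ (suc j)) ∈-allFin
  s = derivationSize refutationLabels
  x = formulaLength (2 + j , parityPair (2 + j))
  len : length xs ≡ suc j
  len = length-tabulate id
  -- The formula has length 7 + 2 j, which splits into a + j and b + j.
  ≤x : ∀ a b → a + b ≡ 7 → a + j ≤ x
  ≤x a b eq = begin
    a + j
      ≤⟨ m≤m+n (a + j) (b + j) ⟩
    (a + j) + (b + j)
      ≡⟨ solve 3 (λ a b j → (a :+ j) :+ (b :+ j) := (a :+ b) :+ j :* con 2) refl a b j ⟩
    (a + b) + j * 2
      ≡⟨ cong (_+ j * 2) eq ⟩
    7 + j * 2
      ≡⟨ formulaLength-parityPair (2 + j) ⟨
    x ∎

-- The family and the separation.

-- The number of variables is even for the pairing in `duplicate`, and `suc i * 2` unfolds to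
-- `2 + i * 2`, the form that `UpperBound` needs.
parityFormula : ℕ → Formula
parityFormula i = suc i * 2 , parityPair (suc i * 2)

corollary1 : ∃ λ (𝓕 : Pred Formula 0ℓ) →
    Infinite 𝓕 ×
    (∀ φ → 𝓕 φ → Unsatisfiable φ) ×
    PolynomialProofs parityAllowed 𝓕 ×
    ¬ PolynomialProofs implicativeOnly 𝓕
corollary1 =
  (λ φ → ∃ λ i → φ ≡ parityFormula i) ,
  (parityFormula , injective , λ i → i , refl) ,
  (λ { _ (i , refl) → parityPair-unsat (suc i * 2) }) ,
  (proofBound , λ { _ (i , refl) → parity-upper-bound (i * 2) }) ,
  λ (p , proofs) →
    let i , small = exponential-beats-polynomial p
        large = implicative-lower-bound (suc i) (proofs (parityFormula i) (i , refl))
    in <⇒≱ small (subst (λ x → 2 ^ suc i ≤ eval p x) (formulaLength-parityPair (suc i * 2)) large)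
  where
  injective : ∀ {i j} → parityFormula i ≡ parityFormula j → i ≡ j
  injective {i} {j} eq = cong pred (*-cancelʳ-≡ (suc i) (suc j) 2 (cong proj₁ eq))
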